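{- For every fixed integer $\ell \geq 0$, the problems \textsc{wc-$(0,\ell)$g} and \textsc{wc-$(1,\ell)$g} can be solved in polynomial time.
   Context: All graphs are finite and simple. An $(r,\ell)$-partition of a graph $G$ is a partition of $V(G)$ into $r$ independent sets and $\ell$ cliques (parts may be empty); $G$ is an $(r,\ell)$-graph if it admits one. A graph is well-covered if all its maximal independent sets have the same cardinality. For fixed $r,\ell$, the problem \textsc{wc-$(r,\ell)$g} takes as input an $(r,\ell)$-graph $G$ together with an $(r,\ell)$-partition of $V(G)$ and asks whether $G$ is well-covered. -}

module Defs where

open import Data.Bool using (Bool; true; false; if_then_else_)
open import Data.Fin using (Fin; toℕ; join)
open import Data.Fin.Subset using (Subset; _∈_; _⊆_; ∣_∣)
open import Data.List using (List; []; _∷_; _++_; length; map; concatMap; replicate; foldr; allFin)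
open import Data.Maybe using (Maybe; just; nothing)
open import Data.Nat using (ℕ; suc; _+_; _*_)
open import Data.Nat.GeneralisedArithmetic using (iterate)
open import Data.Product using (Σ; ∃; ∃-syntax; _×_; _,_)
open import Data.Sum using (_⊎_; inj₁; inj₂)
open import Data.Vec using (Vec; _∷_)
import Data.Vec as Vec
open import Function.Bundles using (_↔_)
open import Level using (0ℓ)
open import Relation.Binary.Core using (Rel)
open import Relation.Binary.Definitions using (Decidable; Symmetric; Irreflexive)
open import Relation.Binary.PropositionalEquality using (_≡_; _≢_)
open import Relation.Nullary using (¬_; does)
open import Relation.Nullary.Reflects using (Reflects)
open import Relation.Unary using (Pred)

record Graph (n : ℕ) : Set₁ where
  field
    _~_      : Rel (Fin n) 0ℓ
    ~-sym    : Symmetric _~_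
    ~-irrefl : Irreflexive _≡_ _~_
    _~?_     : Decidable _~_

module _ {n : ℕ} (G : Graph n) where
  open Graph G

  Independent : Pred (Fin n) 0ℓ → Set
  Independent P = ∀ {u v} → P u → P v → ¬ (u ~ v)

  Clique : Pred (Fin n) 0ℓ → Set
  Clique P = ∀ {u v} → P u → P v → u ≢ v → u ~ v

  MaximalIndependent : Subset n → Set
  MaximalIndependent S =
    Independent (_∈ S) × (∀ (T : Subset n) → Independent (_∈ T) → S ⊆ T → T ⊆ S)

  WellCovered : Set
  WellCovered = ∀ (S T : Subset n) →
    MaximalIndependent S → MaximalIndependent T → ∣ S ∣ ≡ ∣ T ∣

  -- The parts are the fibres of `part`, so they are disjoint, cover all
  -- vertices and may be empty.
  record Partition (r l : ℕ) : Set where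
    field
      part        : Fin n → Fin r ⊎ Fin l
      independent : ∀ i → Independent (λ v → part v ≡ inj₁ i)
      clique      : ∀ j → Clique (λ v → part v ≡ inj₂ j)

data Letter : Set where
  𝟎 𝟏 ♯ : Letter

Word : Set
Word = List Letter

Finite : Set → Set
Finite A = ∃[ k ] (A ↔ Fin k)

data Move : Set where
  left stay right : Move

-- Two-way infinite tape.  `before` lists the cells to the left of the head,
-- nearest first; `nothing` is the blank, which also fills every cell beyond
-- the two lists.
record Tape (A : Set) : Set where
  constructor tape
  field
    before : List (Maybe A)
    head   : Maybe A
    after  : List (Maybe A)

blankTape : ∀ {A} → Tape A
blankTape = tape [] nothing []

writeMove : ∀ {A} → Maybe A × Move → Tape A → Tape A
writeMove (x , stay)  (tape ls       _ rs)       = tape ls x rs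
writeMove (x , left)  (tape []       _ rs)       = tape [] nothing (x ∷ rs)
writeMove (x , left)  (tape (l ∷ ls) _ rs)       = tape ls l (x ∷ rs)
writeMove (x , right) (tape ls       _ [])       = tape (x ∷ ls) nothing []
writeMove (x , right) (tape ls       _ (r ∷ rs)) = tape (x ∷ ls) r rs

data Control (Q : Set) : Set where
  goto : Q → Control Q
  halt : Bool → Control Q

-- The first tape is the input tape.  The halting states (accepting and
-- rejecting) are `halt true` and `halt false`, not elements of `State`.
record TuringMachine : Set₁ where
  field
    workTapes     : ℕ
    State         : Set
    State-finite  : Finite State
    Extra         : Set
    Extra-finite  : Finite Extra

  -- The non-blank tape symbols.
  Symbol : Set
  Symbol = Letter ⊎ Extra

  field
    start : State
    δ     : State → Vec (Maybe Symbol) (suc workTapes) →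
            Control State × Vec (Maybe Symbol × Move) (suc workTapes)

  Config : Set
  Config = Control State × Vec (Tape Symbol) (suc workTapes)

  step : Config → Config
  step (halt b , ts) = halt b , ts
  step (goto q , ts) =
    let c , actions = δ q (Vec.map Tape.head ts)
    in  c , Vec.zipWith writeMove actions ts

  inputTape : Word → Tape Symbol
  inputTape []      = blankTape
  inputTape (a ∷ w) = tape [] (just (inj₁ a)) (map (λ b → just (inj₁ b)) w)

  initial : Word → Config
  initial w = goto start , inputTape w ∷ Vec.replicate workTapes blankTape

  HaltsWithin : ℕ → Word → Bool → Set
  HaltsWithin t w b = ∃[ ts ] (iterate step (initial w) t ≡ (halt b , ts))

record DecisionProblem : Set₂ where
  field
    Instance : Set₁
    encode   : Instance → Word
    Yes      : Instance → Set

-- The polynomial with the given coefficients, constant coefficient first.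
evalPoly : List ℕ → ℕ → ℕ
evalPoly p x = foldr (λ a y → a + x * y) 0 p

-- Nothing is required of the machine on words that encode no instance.
PolynomialTime : DecisionProblem → Set₁
PolynomialTime Π =
  Σ TuringMachine λ M → Σ (List ℕ) λ p → ∀ (x : Instance) →
    ∃[ b ] (TuringMachine.HaltsWithin M (evalPoly p (length (encode x))) (encode x) b
            × Reflects (Yes x) b)
  where open DecisionProblem Π

record PartitionedGraph (r l : ℕ) : Set₁ where
  field
    {order}   : ℕ
    graph     : Graph order
    partition : Partition graph r l

-- For each vertex in turn: the index of its part in unary (independent sets
-- numbered before cliques), then its row of the adjacency matrix, each
-- terminated by ♯.
encodePartitionedGraph : ∀ {r l} → PartitionedGraph r l → Word
encodePartitionedGraph {r} {l} I = concatMap vertexCode (allFin order)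
  where
  open PartitionedGraph I
  open Graph graph
  open Partition partition

  vertexCode : Fin order → Word
  vertexCode v =
    replicate (toℕ (join r l (part v))) 𝟏 ++ ♯ ∷
    map (λ u → if does (v ~? u) then 𝟏 else 𝟎) (allFin order) ++ ♯ ∷ []

WC-⟨_,_⟩G : ℕ → ℕ → DecisionProblem
WC-⟨ r , l ⟩G = record
  { Instance = PartitionedGraph r l
  ; encode   = encodePartitionedGraph
  ; Yes      = λ I → WellCovered (PartitionedGraph.graph I)
  }

{-# OPTIONS --safe #-}
module Submission where

-- Let S be the independent part (empty when r = 0).  A maximal independent set
-- I meets each of the l cliques at most once, so I ∖ S is a set K of at most l
-- vertices, and I = K ∪ (S ∖ N(K)).  Hence G is well-covered if and only if, for
-- all tuples K, K′ of at most l vertices, the candidates K ∪ (S ∖ N(K)) and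
-- K′ ∪ (S ∖ N(K′)) have the same size whenever both are maximal independent sets.
--
-- The Turing machine has one work tape, with one cell per vertex.  A cell has 2l
-- tracks, each of which marks at most one vertex; they hold K and K′.  For fixed
-- K and K′, two passes over the input compute the candidates and then test them:
-- X is a maximal independent set if and only if each vertex is either in X or
-- adjacent to X, but not both.  Reading the row of a vertex in lockstep with the
-- work tape yields whether it has a neighbour in a set stored there.  Sizes are
-- compared by repeatedly deleting one vertex from each candidate.  Finally the
-- tracks are advanced like an odometer, so that (n + 1)^(2l) pairs are tested.

open import Defs
open import Data.Bool using (Bool; true; false; not; _∧_; _∨_; _xor_; if_then_else_)
open import Data.Bool.ListAction using (all; and)
open import Data.Fin using (Fin; zero; suc; join; splitAt; toℕ; fromℕ; inject₁)
open import Data.Fin.Induction using (>-weakInduction)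
open import Data.Fin.Patterns using (0F; 1F; 2F; 3F)
open import Data.Fin.Properties
  using (1↔⊤; 2↔Bool; +↔⊎; *↔×; toℕ-fromℕ; toℕ-inject₁; toℕ<n; toℕ-injective; any?)
open import Data.Fin.Subset using (Subset; _∈_; _⊆_; ∣_∣; _∪_; ⁅_⁆)
open import Data.Fin.Subset.Properties using (p⊆p∪q; x∈p∪q⁺; x∈p∪q⁻; x∈⁅x⁆; x∈⁅y⁆⇒x≡y)
open import Data.List using (List; []; _∷_; _++_; length; map; _ʳ++_; tabulate; replicate; concatMap; allFin)
open import Data.List.Properties
  using ( ʳ++-ʳ++; ++-ʳ++; length-ʳ++; length-++; ++-assoc; length-map; length-tabulate; length-replicate
        ; ∷ʳ-++; map-++; ++-identityʳ; map-tabulate; ∷-injective; map-∘; map-cong )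
open import Data.Maybe using (Maybe; just; nothing)
open import Data.Nat using (ℕ; zero; suc; pred; _+_; _*_; _≤_; _<_; z≤n; s≤s; _≡ᵇ_; _<ᵇ_)
open import Data.Nat.GeneralisedArithmetic using (iterate)
open import Data.Nat.Properties
open import Data.Product using (∃-syntax; _×_; _,_; proj₁; proj₂)
open import Data.Product.Function.NonDependent.Propositional using (_×-↔_)
open import Data.Sum using (_⊎_; inj₁; inj₂)
open import Data.Sum.Function.Propositional using (_⊎-↔_)
open import Data.Unit using (⊤; tt)
open import Data.Vec using (Vec; []; _∷_; lookup; _[_]≔_)
import Data.Vec as Vec
import Data.Bool.Properties as Bool
import Data.Fin.Properties as Fin
import Data.Sum.Properties as Sum
import Data.Vec.Properties as Vec
open import Function.Base using (_∘_; id)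
open import Function.Bundles using (mk↔ₛ′)
open import Function.Properties.Inverse using (↔-sym; ↔-trans; ↔-refl)
open import Relation.Binary.PropositionalEquality
open import Relation.Nullary using (¬_; Dec; does; contradiction; yes; no; _×-dec_)
open import Relation.Nullary.Decidable using (dec-true)
open import Relation.Nullary.Reflects using (Reflects; ofʸ; ofⁿ)

-- Polynomials in one variable

-- Running times are first bounded by ordinary functions of the input length; the combinators below
-- then produce the coefficients by following the shape of the bound.
Polynomial : (ℕ → ℕ) → Set
Polynomial f = ∃[ p ] ∀ x → f x ≡ evalPoly p x

constantᵖ : ∀ k → Polynomial (λ _ → k)
constantᵖ k = k ∷ [] , λ x → sym (trans (cong (k +_) (*-zeroʳ x)) (+-identityʳ k))

identityᵖ : Polynomial (λ x → x)
identityᵖ = 0 ∷ 1 ∷ [] , λ x →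
  sym (trans (cong (λ z → x * suc z) (*-zeroʳ x)) (*-identityʳ x))

infixl 6 _+ᵖ_
infixl 7 _*ᵖ_

addPoly : List ℕ → List ℕ → List ℕ
addPoly []      q       = q
addPoly (a ∷ p) []      = a ∷ p
addPoly (a ∷ p) (b ∷ q) = a + b ∷ addPoly p q

evalPoly-add : ∀ p q x → evalPoly (addPoly p q) x ≡ evalPoly p x + evalPoly q x
evalPoly-add []      q       x = refl
evalPoly-add (a ∷ p) []      x = sym (+-identityʳ _)
evalPoly-add (a ∷ p) (b ∷ q) x
  rewrite evalPoly-add p q x | *-distribˡ-+ x (evalPoly p x) (evalPoly q x)
  = +-interchange a b (x * evalPoly p x) (x * evalPoly q x)
  where
  open import Algebra.Properties.CommutativeSemigroup +-commutativeSemigroup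
    using () renaming (interchange to +-interchange)

scalePoly : ℕ → List ℕ → List ℕ
scalePoly k = map (k *_)

evalPoly-scale : ∀ k p x → evalPoly (scalePoly k p) x ≡ k * evalPoly p x
evalPoly-scale k []      x = sym (*-zeroʳ k)
evalPoly-scale k (a ∷ p) x
  rewrite evalPoly-scale k p x | *-distribˡ-+ k a (x * evalPoly p x)
  = cong (k * a +_) (x∙yz≈y∙xz x k (evalPoly p x))
  where open import Algebra.Properties.CommutativeSemigroup *-commutativeSemigroup

mulPoly : List ℕ → List ℕ → List ℕ
mulPoly []      q = []
mulPoly (a ∷ p) q = addPoly (scalePoly a q) (0 ∷ mulPoly p q)

evalPoly-mul : ∀ p q x → evalPoly (mulPoly p q) x ≡ evalPoly p x * evalPoly q x
evalPoly-mul []      q x = refl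
evalPoly-mul (a ∷ p) q x
  rewrite evalPoly-add (scalePoly a q) (0 ∷ mulPoly p q) x
        | evalPoly-scale a q x | evalPoly-mul p q x
        | *-distribʳ-+ (evalPoly q x) a (x * evalPoly p x)
  = cong (a * evalPoly q x +_) (sym (*-assoc x (evalPoly p x) (evalPoly q x)))

_+ᵖ_ : ∀ {f g} → Polynomial f → Polynomial g → Polynomial (λ x → f x + g x)
(p , f≡p) +ᵖ (q , g≡q) =
  addPoly p q , λ x → trans (cong₂ _+_ (f≡p x) (g≡q x)) (sym (evalPoly-add p q x))

_*ᵖ_ : ∀ {f g} → Polynomial f → Polynomial g → Polynomial (λ x → f x * g x)
(p , f≡p) *ᵖ (q , g≡q) =
  mulPoly p q , λ x → trans (cong₂ _*_ (f≡p x) (g≡q x)) (sym (evalPoly-mul p q x))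

-- Finite types

⊤-finite : Finite ⊤
⊤-finite = 1 , ↔-sym 1↔⊤

Bool-finite : Finite Bool
Bool-finite = 2 , ↔-sym 2↔Bool

Fin-finite : ∀ {k} → Finite (Fin k)
Fin-finite {k} = k , ↔-refl

infixr 2 _⊎-finite_
infixr 3 _×-finite_

_⊎-finite_ : ∀ {A B} → Finite A → Finite B → Finite (A ⊎ B)
(a , f) ⊎-finite (b , g) = a + b , ↔-trans (f ⊎-↔ g) (↔-sym +↔⊎)

_×-finite_ : ∀ {A B} → Finite A → Finite B → Finite (A × B)
(a , f) ×-finite (b , g) = a * b , ↔-trans (f ×-↔ g) (↔-sym *↔×)

Vec-finite : ∀ {A} → Finite A → ∀ k → Finite (Vec A k)
Vec-finite A-finite zero    =
  1 , ↔-trans (mk↔ₛ′ (λ _ → tt) (λ _ → []) (λ _ → refl) (λ { [] → refl })) (↔-sym 1↔⊤)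
Vec-finite A-finite (suc k) =
  let c , f = A-finite ×-finite Vec-finite A-finite k
  in  c , ↔-trans (mk↔ₛ′ (λ { (x ∷ xs) → x , xs }) (λ { (x , xs) → x ∷ xs })
                         (λ { (x , xs) → refl }) (λ { (x ∷ xs) → refl })) f

-- Runs of a Turing machine

module Run (M : TuringMachine) where
  open TuringMachine M

  infix 4 _⟶⟨_⟩_

  -- The index bounds the number of steps and need not equal it, as `stop` accepts every index.
  -- Bounds can therefore be rounded up freely.
  data _⟶⟨_⟩_ : Config → ℕ → Config → Set where
    stop : ∀ {c t} → c ⟶⟨ t ⟩ c
    go   : ∀ {c t d} → step c ⟶⟨ t ⟩ d → c ⟶⟨ suc t ⟩ d

  weaken : ∀ {c d s t} → s ≤ t → c ⟶⟨ s ⟩ d → c ⟶⟨ t ⟩ d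
  weaken s≤t       stop   = stop
  weaken (s≤s s≤t) (go r) = go (weaken s≤t r)

  infixr 5 _⟫_

  _⟫_ : ∀ {c d e s t} → c ⟶⟨ s ⟩ d → d ⟶⟨ t ⟩ e → c ⟶⟨ s + t ⟩ e
  _⟫_ {s = s} {t} stop   r′ = weaken (m≤n+m t s) r′
  go r ⟫ r′ = go (r ⟫ r′)

  iterate-halted : ∀ b ts t → iterate step (halt b , ts) t ≡ (halt b , ts)
  iterate-halted b ts zero    = refl
  iterate-halted b ts (suc t) = iterate-halted b ts t

  -- A halting configuration is a fixed point of `step`, so a run that ends early is still there
  -- after the full number of steps.
  run-halts : ∀ {c t b ts} → c ⟶⟨ t ⟩ (halt b , ts) → iterate step c t ≡ (halt b , ts)
  run-halts {t = t} stop   = iterate-halted _ _ t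
  run-halts         (go r) = run-halts r

-- Tapes whose written cells are delimited by one blank on each side

module _ {X Y : Set} (f : X → Y) where

  cell : X → Maybe Y
  cell x = just (f x)

  -- Tapes are compared as lists, so explicit blanks count. With one blank kept beyond each end, a
  -- head that runs past an end and comes back finds a tape of the same form.
  delimited : List X → List (Maybe Y)
  delimited []       = nothing ∷ []
  delimited (x ∷ xs) = cell x ∷ delimited xs

  at : List X → List X → Tape Y
  at ls []       = tape (delimited ls) nothing []
  at ls (x ∷ rs) = tape (delimited ls) (cell x) (delimited rs)

  leftOf : List X → List X → Tape Y
  leftOf []       rs = tape [] nothing (delimited rs)
  leftOf (l ∷ ls) rs = at ls (l ∷ rs)

  -- The right end of the input has not been delimited by a blank yet.
  unseen : List X → List X → Tape Y
  unseen ls []       = tape (delimited ls) nothing []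
  unseen ls (x ∷ rs) = tape (delimited ls) (cell x) (map cell rs)

  at-left : ∀ ls rs → writeMove (Tape.head (at ls rs) , left) (at ls rs) ≡ leftOf ls rs
  at-left []       []       = refl
  at-left []       (r ∷ rs) = refl
  at-left (l ∷ ls) []       = refl
  at-left (l ∷ ls) (r ∷ rs) = refl

  at-right : ∀ ls x y rs → writeMove (cell y , right) (at ls (x ∷ rs)) ≡ at (y ∷ ls) rs
  at-right ls x y []       = refl
  at-right ls x y (r ∷ rs) = refl

  leftOf-left : ∀ l ls rs → writeMove (cell l , left) (leftOf (l ∷ ls) rs) ≡ leftOf ls (l ∷ rs)
  leftOf-left l []       rs = refl
  leftOf-left l (_ ∷ ls) rs = refl

  leftOf-right : ∀ rs → writeMove (nothing , right) (leftOf [] rs) ≡ at [] rs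
  leftOf-right []       = refl
  leftOf-right (r ∷ rs) = refl

  unseen-right : ∀ ls x rs → writeMove (cell x , right) (unseen ls (x ∷ rs)) ≡ unseen (x ∷ ls) rs
  unseen-right ls x []       = refl
  unseen-right ls x (r ∷ rs) = refl

-- The machine

-- One bit for each of the two candidate sets, which are treated simultaneously; sweeps also use
-- such pairs as automaton states.
Two : Set
Two = Bool × Bool

pattern ff = false , false
pattern tr = true , true

infixr 5 _∨²_
infixr 6 _∧²_

_∨²_ _∧²_ _xor²_ : Two → Two → Two
(a , b) ∨²   (c , d) = a ∨ c , b ∨ d
(a , b) ∧²   (c , d) = a ∧ c , b ∧ d
(a , b) xor² (c , d) = a xor c , b xor d

not² : Two → Two
not² (a , b) = not a , not b

both : Bool → Two
both a = a , a

-- A pass over the input computes one new value per vertex.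
Pass : Set
Pass = Bool

pattern compute = false
pattern verify  = true

or : ∀ {k} → Vec Bool k → Bool
or = Vec.foldr _ _∨_ false

module Machine (useS : Bool) (l : ℕ) where

  m : ℕ
  m = l + l

  -- The work tape has one cell per vertex v: the bits telling which of the m
  -- tracks point to v, whether v was dealt with in the current pass,
  -- membership of v in the two candidate sets, and whether v is compatible
  -- with them.
  Cell : Set
  Cell = Vec Bool m × Bool × Two × Two

  chosen : Vec Bool m → Two
  chosen ms = or (Vec.take l ms) , or (Vec.drop l ms)

  -- The three `clear` sweeps act alike on cells; the index records which phase has ended
  -- (initialisation, `compute`, `verify`) and hence what follows. An `update` carries whether the
  -- vertex just read lies in the independent part and whether it has a neighbour in each inspected
  -- set.
  Op : Set
  Op = Fin 3 ⊎ (Pass × Bool × Two) ⊎ ⊤ ⊎ Fin m ⊎ Fin m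

  pattern clear k       = inj₁ k
  pattern update p s nb = inj₂ (inj₁ (p , s , nb))
  pattern cancel        = inj₂ (inj₂ (inj₁ tt))
  pattern advance i     = inj₂ (inj₂ (inj₂ (inj₁ i)))
  pattern reset i       = inj₂ (inj₂ (inj₂ (inj₂ i)))

  After : Set
  After = Op ⊎ Pass

  pattern sweep o = inj₁ o
  pattern pass  p = inj₂ p

  -- The `init` states delimit the tapes and create one cell per letter of the first row. `header`,
  -- `skip` and `row` read a vertex code, `inputBack` rewinds the input, `scan` and `back` sweep the
  -- work tape and return.
  State : Set
  State = Fin 4 ⊎ Bool ⊎ Pass ⊎ Pass ⊎ (Pass × Bool × Two) ⊎ Op ⊎ (Op × Two) ⊎ After

  pattern init₀        = inj₁ 0F
  pattern init₁        = inj₁ 1F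
  pattern init₂        = inj₁ 2F
  pattern init₄        = inj₁ 3F
  pattern init₃ first  = inj₂ (inj₁ first)
  pattern header p     = inj₂ (inj₂ (inj₁ p))
  pattern skip p       = inj₂ (inj₂ (inj₂ (inj₁ p)))
  pattern row p s acc  = inj₂ (inj₂ (inj₂ (inj₂ (inj₁ (p , s , acc)))))
  pattern inputBack o  = inj₂ (inj₂ (inj₂ (inj₂ (inj₂ (inj₁ o)))))
  pattern scan o b     = inj₂ (inj₂ (inj₂ (inj₂ (inj₂ (inj₂ (inj₁ (o , b)))))))
  pattern back τ       = inj₂ (inj₂ (inj₂ (inj₂ (inj₂ (inj₂ (inj₂ τ))))))

  Two-finite : Finite Two
  Two-finite = Bool-finite ×-finite Bool-finite

  Op-finite : Finite Op
  Op-finite = Fin-finite ⊎-finite (Bool-finite ×-finite Bool-finite ×-finite Two-finite)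
    ⊎-finite ⊤-finite ⊎-finite Fin-finite ⊎-finite Fin-finite

  State-finite : Finite State
  State-finite = Fin-finite ⊎-finite Bool-finite ⊎-finite Bool-finite ⊎-finite Bool-finite
    ⊎-finite (Bool-finite ×-finite Bool-finite ×-finite Two-finite)
    ⊎-finite Op-finite ⊎-finite (Op-finite ×-finite Two-finite)
    ⊎-finite (Op-finite ⊎-finite Bool-finite)

  Cell-finite : Finite Cell
  Cell-finite = Vec-finite Bool-finite m ×-finite Bool-finite ×-finite Two-finite ×-finite Two-finite

  inspected : Pass → Cell → Two
  inspected compute (ms , _ , x , _) = chosen ms
  inspected verify  (ms , _ , x , _) = x

  -- A `compute` pass inspects the tracks and writes `x`; a `verify` pass inspects `x` and writes
  -- `y`. No pass changes what it inspects, so cells can be updated in place.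
  write : Pass → Bool → Two → Cell → Cell
  write compute s nb (ms , _ , x , y) = ms , true , chosen ms ∨² both s ∧² not² nb , y
  write verify  s nb (ms , _ , x , y) = ms , true , x , x xor² nb

  blankCell : Vec Bool m → Cell
  blankCell ms = ms , false , ff , ff

  -- Each operation is a left-to-right sweep of the work tape by an automaton
  -- with state in Two.  A cancel sweep removes the first remaining member of each
  -- candidate set.  An advance sweep looks for the marked cell in state
  -- (false , _), marks the next one in state (true , false), and is done in
  -- state (true , true); when the last cell was marked, no cell is marked
  -- afterwards, which is the last position of a track.
  act : Op → Two → Cell → Two × Cell
  act (clear _)       (b , b′)     (ms , d , x , y)       = (b ∨ not (proj₁ y ∧ proj₂ y) , b′) , (ms , false , x , y)
  act (update p s nb) (true , b′)  c                      = (true , b′) , c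
  act (update p s nb) (false , b′) c@(ms , true , r)      = (false , b′) , c
  act (update p s nb) (false , b′) c@(ms , false , r)     = (true , b′) , write p s nb c
  act cancel          b            (ms , d , x , y)       = b ∨² x , (ms , d , b ∧² x , y)
  act (advance i)     (false , b′) (ms , _)               = (lookup ms i , b′) , blankCell (ms [ i ]≔ false)
  act (advance i)     (true , b′)  (ms , _)               = (true , true) , blankCell (ms [ i ]≔ not b′)
  act (reset i)       (b , b′)     (ms , _)               = (true , b′) , blankCell (ms [ i ]≔ not b)

  -- At argument `i` the tracks from `i` on have run through all their positions, so track `i - 1`
  -- is advanced: the last track is the fastest digit. Argument `m` follows a single test; at
  -- argument 0 every pair has passed.
  next-track : Fin (suc m) → Control State
  next-track zero    = halt true
  next-track (suc i) = goto (back (sweep (advance i)))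

  decide : Op → Two → Control State
  decide (clear 0F)       _           = goto (back (pass compute))
  decide (clear 1F)       _           = goto (back (pass verify))
  -- Some vertex is incompatible with one of the candidates, so the pair imposes no condition.
  decide (clear 2F)       (true , _)  = next-track (fromℕ m)
  decide (clear 2F)       (false , _) = goto (back (sweep cancel))
  decide (update p _ _)   _           = goto (back (pass p))
  decide cancel           tr          = goto (back (sweep cancel))
  decide cancel           ff          = next-track (fromℕ m)
  -- Exactly one of the two sets is exhausted, so the sizes differ.
  decide cancel           _           = halt false
  decide (advance i)      (true , _)  = goto (back (pass compute))
  decide (advance i)      (false , _) = goto (back (sweep (reset i)))
  decide (reset i)        _           = next-track (inject₁ i)

  resume : After → State
  resume (sweep o) = scan o ff
  resume (pass p) = header p

  afterPass : Pass → Op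
  afterPass compute = clear 1F
  afterPass verify  = clear 2F

  Symbol : Set
  Symbol = Letter ⊎ Cell

  Action : Set
  Action = Control State × Vec (Maybe Symbol × Move) 2

  bit : Letter → Bool
  bit 𝟏 = true
  bit _ = false

  firstMark : Bool → Cell
  firstMark first = blankCell (Vec.replicate m first)

  -- The behaviour in situations that never occur is arbitrary.
  δ′ : State → Maybe Symbol → Maybe Symbol → Action
  -- Stepping left and back leaves an explicit blank to the left of both tapes.
  δ′ init₀ a c = goto init₁ , (a , left) ∷ (c , left) ∷ []
  δ′ init₁ a c = goto init₂ , (a , right) ∷ (c , right) ∷ []
  δ′ init₂ nothing           c = goto (inputBack (clear 0F)) , (nothing , left) ∷ (c , stay) ∷ []
  δ′ init₂ a@(just (inj₁ ♯)) c = goto (init₃ true) , (a , right) ∷ (c , stay) ∷ []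
  δ′ init₂ a@(just _)        c = goto init₂ , (a , right) ∷ (c , stay) ∷ []
  δ′ (init₃ first) nothing           c = goto (inputBack (clear 0F)) , (nothing , left) ∷ (c , stay) ∷ []
  δ′ (init₃ first) a@(just (inj₁ ♯)) c = goto init₄ , (a , right) ∷ (c , stay) ∷ []
  δ′ (init₃ first) a@(just _)        c = goto (init₃ false) , (a , right) ∷ (just (inj₂ (firstMark first)) , right) ∷ []
  δ′ init₄ nothing    c = goto (inputBack (clear 0F)) , (nothing , left) ∷ (c , stay) ∷ []
  δ′ init₄ a@(just _) c = goto init₄ , (a , right) ∷ (c , stay) ∷ []
  δ′ (header p) nothing           c = goto (inputBack (afterPass p)) , (nothing , left) ∷ (c , stay) ∷ []
  δ′ (header p) a@(just (inj₁ ♯)) c = goto (row p useS ff) , (a , right) ∷ (c , stay) ∷ []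
  δ′ (header p) a@(just _)        c = goto (skip p) , (a , right) ∷ (c , stay) ∷ []
  δ′ (skip p) a@(just (inj₁ 𝟏)) c = goto (skip p) , (a , right) ∷ (c , stay) ∷ []
  δ′ (skip p) a                 c = goto (row p false ff) , (a , right) ∷ (c , stay) ∷ []
  δ′ (row p s acc) a@(just (inj₁ x)) c@(just (inj₂ y)) =
    goto (row p s (acc ∨² both (bit x) ∧² inspected p y)) , (a , right) ∷ (c , right) ∷ []
  -- The work head has reached the right blank; by lockstep the input head is then on the `♯` that
  -- ends the row.
  δ′ (row p s acc) a c = goto (back (sweep (update p s acc))) , (a , right) ∷ (c , left) ∷ []
  δ′ (inputBack o) nothing    c = goto (scan o ff) , (nothing , right) ∷ (c , stay) ∷ []
  δ′ (inputBack o) a@(just _) c = goto (inputBack o) , (a , left) ∷ (c , stay) ∷ []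
  δ′ (scan o b) a (just (inj₂ c)) =
    let b′ , c′ = act o b c in goto (scan o b′) , (a , stay) ∷ (just (inj₂ c′) , right) ∷ []
  δ′ (scan o b) a c = decide o b , (a , stay) ∷ (c , left) ∷ []
  δ′ (back τ) a nothing    = goto (resume τ) , (a , stay) ∷ (nothing , right) ∷ []
  δ′ (back τ) a c@(just _) = goto (back τ) , (a , stay) ∷ (c , left) ∷ []

  machine : TuringMachine
  machine = record
    { workTapes    = 1
    ; State        = State
    ; State-finite = State-finite
    ; Extra        = Cell
    ; Extra-finite = Cell-finite
    ; start        = init₀
    ; δ            = λ { q (a ∷ c ∷ []) → δ′ q a c }
    }

  open TuringMachine machine using (Config; step; initial)
  open Run machine public

  inp : List Letter → List Letter → Tape Symbol
  inp = at inj₁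

  work : List Cell → List Cell → Tape Symbol
  work = at inj₂

  workLeft : List Cell → List Cell → Tape Symbol
  workLeft = leftOf inj₂

  -- The step itself is checked by computation, while the tapes it produces are brought back to
  -- delimited form by the tape lemmas.
  move : ∀ {c q t t′ u u′ n d} → step c ≡ (q , t ∷ u ∷ []) → t ≡ t′ → u ≡ u′ →
         (q , t′ ∷ u′ ∷ []) ⟶⟨ n ⟩ d → c ⟶⟨ suc n ⟩ d
  move s refl refl r = go (subst (_⟶⟨ _ ⟩ _) (sym s) r)

  -- Sweeps

  final : Op → Two → List Cell → Two
  final o b []       = b
  final o b (c ∷ cs) = final o (proj₁ (act o b c)) cs

  swept : Op → Two → List Cell → List Cell
  swept o b []       = []
  swept o b (c ∷ cs) = proj₂ (act o b c) ∷ swept o (proj₁ (act o b c)) cs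

  length-swept : ∀ o b cs → length (swept o b cs) ≡ length cs
  length-swept o b []       = refl
  length-swept o b (c ∷ cs) = cong suc (length-swept o (proj₁ (act o b c)) cs)

  scan-run : ∀ o b t ls rs →
    (goto (scan o b) , t ∷ work ls rs ∷ []) ⟶⟨ suc (length rs) ⟩
    (decide o (final o b rs) , t ∷ workLeft (swept o b rs ʳ++ ls) [] ∷ [])
  scan-run o b t ls []       = move refl refl (at-left inj₂ ls []) stop
  scan-run o b t ls (c ∷ rs) =
    move refl refl (at-right inj₂ ls c (proj₂ (act o b c)) rs)
      (scan-run o (proj₁ (act o b c)) t (proj₂ (act o b c) ∷ ls) rs)

  back-run : ∀ τ t ls rs →
    (goto (back τ) , t ∷ workLeft ls rs ∷ []) ⟶⟨ suc (length ls) ⟩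
    (goto (resume τ) , t ∷ work [] (ls ʳ++ rs) ∷ [])
  back-run τ t []       rs = move refl refl (leftOf-right inj₂ rs) stop
  back-run τ t (x ∷ ls) rs = move refl refl (leftOf-left inj₂ x ls rs) (back-run τ t ls (x ∷ rs))

  inputBack-run : ∀ o t ls rs →
    (goto (inputBack o) , leftOf inj₁ ls rs ∷ t ∷ []) ⟶⟨ suc (length ls) ⟩
    (goto (scan o ff) , inp [] (ls ʳ++ rs) ∷ t ∷ [])
  inputBack-run o t []       rs = move refl (leftOf-right inj₁ rs) refl stop
  inputBack-run o t (x ∷ ls) rs = move refl (leftOf-left inj₁ x ls rs) refl (inputBack-run o t ls (x ∷ rs))

-- Neighbour tests and counting along lists of vertices

hits : ∀ {A : Set} → Bool → (A → Bool) → (A → Bool) → List A → Bool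
hits acc e X []       = acc
hits acc e X (u ∷ us) = hits (acc ∨ e u ∧ X u) e X us

count : ∀ {A : Set} → (A → Bool) → List A → ℕ
count x []       = 0
count x (u ∷ us) = (if x u then suc else id) (count x us)

count-map : ∀ {A B : Set} (x : B → Bool) (C : A → B) us → count x (map C us) ≡ count (x ∘ C) us
count-map x C []       = refl
count-map x C (u ∷ us) with x (C u)
... | true  = cong suc (count-map x C us)
... | false = count-map x C us

count≤length : ∀ {A : Set} (x : A → Bool) us → count x us ≤ length us
count≤length x []       = z≤n
count≤length x (u ∷ us) with x u
... | true  = s≤s (count≤length x us)
... | false = m≤n⇒m≤1+n (count≤length x us)

letter : Bool → Letter
letter b = if b then 𝟏 else 𝟎

-- Effect of single rows and sweeps

module Passes (useS : Bool) (l : ℕ) where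
  open Machine useS l
  open TuringMachine machine using (Config)

  -- Independent sets are numbered before cliques, so index 0 is the independent part when r = 1 but
  -- already a clique when r = 0; `useS` tells the two cases apart.
  inS : ℕ → Bool
  inS zero    = useS
  inS (suc _) = false

  skip-run : ∀ p k t ls xs →
    (goto (skip p) , inp ls (replicate k 𝟏 ++ ♯ ∷ xs) ∷ t ∷ []) ⟶⟨ suc k ⟩
    (goto (row p false ff) , inp (♯ ∷ (replicate k 𝟏 ʳ++ ls)) xs ∷ t ∷ [])
  skip-run p zero    t ls xs = move refl (at-right inj₁ ls ♯ ♯ xs) refl stop
  skip-run p (suc k) t ls xs = move refl (at-right inj₁ ls 𝟏 𝟏 _) refl (skip-run p k t (𝟏 ∷ ls) xs)

  header-run : ∀ p k t ls xs →
    (goto (header p) , inp ls (replicate k 𝟏 ++ ♯ ∷ xs) ∷ t ∷ []) ⟶⟨ suc k ⟩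
    (goto (row p (inS k) ff) , inp (♯ ∷ (replicate k 𝟏 ʳ++ ls)) xs ∷ t ∷ [])
  header-run p zero    t ls xs = move refl (at-right inj₁ ls ♯ ♯ xs) refl stop
  header-run p (suc k) t ls xs = move refl (at-right inj₁ ls 𝟏 𝟏 _) refl (skip-run p k t (𝟏 ∷ ls) xs)

  gather : ∀ {A : Set} → Pass → Two → (A → Bool) → List A → List Cell → Two
  gather p acc e (u ∷ us) (c ∷ cs) = gather p (acc ∨² both (e u) ∧² inspected p c) e us cs
  gather p acc e _        _        = acc

  row-run : ∀ {A : Set} p s acc (e : A → Bool) us cs ls ms xs → length us ≡ length cs →
    (goto (row p s acc) , inp ls (map (λ u → letter (e u)) us ++ ♯ ∷ xs) ∷ work ms cs ∷ []) ⟶⟨ suc (length cs) ⟩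
    (goto (back (sweep (update p s (gather p acc e us cs)))) ,
     inp (♯ ∷ (map (λ u → letter (e u)) us ʳ++ ls)) xs ∷ workLeft (cs ʳ++ ms) [] ∷ [])
  row-run p s acc e [] [] ls ms xs _ =
    move refl (at-right inj₁ ls ♯ ♯ xs) (at-left inj₂ ms []) stop
  row-run p s acc e (u ∷ us) (c ∷ cs) ls ms xs eq with e u
  ... | true  = move refl (at-right inj₁ ls 𝟏 𝟏 _) (at-right inj₂ ms c c cs)
                  (row-run p s _ e us cs (𝟏 ∷ ls) (c ∷ ms) xs (suc-injective eq))
  ... | false = move refl (at-right inj₁ ls 𝟎 𝟎 _) (at-right inj₂ ms c c cs)
                  (row-run p s _ e us cs (𝟎 ∷ ls) (c ∷ ms) xs (suc-injective eq))

  scan-back-run : ∀ o b t cs τ → decide o (final o b cs) ≡ goto (back τ) →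
    (goto (scan o b) , t ∷ work [] cs ∷ []) ⟶⟨ suc (length cs) + suc (length cs) ⟩
    (goto (resume τ) , t ∷ work [] (swept o b cs) ∷ [])
  scan-back-run o b t cs τ eq =
    subst (λ q → (goto (scan o b) , t ∷ work [] cs ∷ []) ⟶⟨ suc (length cs) ⟩
                 (q , t ∷ workLeft (swept o b cs ʳ++ []) [] ∷ [])) eq (scan-run o b t [] cs)
    ⟫ subst₂ (λ k zs → (goto (back τ) , t ∷ workLeft (swept o b cs ʳ++ []) [] ∷ []) ⟶⟨ suc k ⟩
                       (goto (resume τ) , t ∷ work [] zs ∷ []))
        (trans (length-ʳ++ (swept o b cs)) (trans (+-identityʳ _) (length-swept o b cs)))
        (trans (ʳ++-ʳ++ (swept o b cs)) (++-identityʳ _))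
        (back-run τ t (swept o b cs ʳ++ []) [])

  isDone : Cell → Bool
  isDone (_ , d , _) = d

  write-isDone : ∀ p s nb c → isDone (write p s nb c) ≡ true
  write-isDone compute s nb c = refl
  write-isDone verify  s nb c = refl

  write-inspected : ∀ p s nb c → inspected p (write p s nb c) ≡ inspected p c
  write-inspected compute s nb c = refl
  write-inspected verify  s nb c = refl

  swept-updated : ∀ p s nb b cs → swept (update p s nb) (true , b) cs ≡ cs
  swept-updated p s nb b []       = refl
  swept-updated p s nb b (c ∷ cs) = cong (c ∷_) (swept-updated p s nb b cs)

  act-done : ∀ p s nb c → isDone c ≡ true → act (update p s nb) ff c ≡ (ff , c)
  act-done p s nb (_ , true , _) refl = refl

  act-undone : ∀ p s nb c → isDone c ≡ false →
               act (update p s nb) ff c ≡ ((true , false) , write p s nb c)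
  act-undone p s nb (_ , false , _) refl = refl

  -- No position is ever stored: vertices are read in tape order, so the first cell not yet done
  -- belongs to the vertex whose row has just been read.
  swept-update : ∀ {A : Set} p s nb (C′ : A → Cell) us c cs →
    (∀ u → isDone (C′ u) ≡ true) → isDone c ≡ false →
    swept (update p s nb) ff (map C′ us ++ c ∷ cs) ≡ map C′ us ++ write p s nb c ∷ cs
  swept-update p s nb C′ []       c cs _  nd rewrite act-undone p s nb c nd =
    cong (write p s nb c ∷_) (swept-updated p s nb false cs)
  swept-update p s nb C′ (u ∷ us) c cs dn nd rewrite act-done p s nb (C′ u) (dn u) =
    cong (C′ u ∷_) (swept-update p s nb C′ us c cs dn nd)

  -- `hits` accumulates in the same order as the `row` state, so each letter is matched by
  -- computation.
  gather-hits : ∀ {A : Set} p a b (e : A → Bool) (C : A → Cell) us →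
    gather p (a , b) e us (map C us) ≡
    (hits a e (proj₁ ∘ inspected p ∘ C) us , hits b e (proj₂ ∘ inspected p ∘ C) us)
  gather-hits p a b e C []       = refl
  gather-hits p a b e C (u ∷ us) = gather-hits p _ _ e C us

  -- Later rows are evaluated on a partly updated tape but see the original sets, because updates
  -- preserve what is inspected.
  gather-processed : ∀ {A : Set} p acc (e : A → Bool) (C C′ : A → Cell) us vs →
    (∀ u → inspected p (C′ u) ≡ inspected p (C u)) →
    gather p acc e (us ++ vs) (map C′ us ++ map C vs) ≡ gather p acc e (us ++ vs) (map C (us ++ vs))
  gather-processed p acc e C C′ []       vs eq = refl
  gather-processed p acc e C C′ (u ∷ us) vs eq rewrite eq u = gather-processed p _ e C C′ us vs eq

  swept-clear : ∀ {A : Set} j b (M : A → Vec Bool m) (d : A → Bool) (x y : A → Two) us →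
    swept (clear j) b (map (λ u → M u , d u , x u , y u) us) ≡ map (λ u → M u , false , x u , y u) us
  swept-clear j b M d x y []       = refl
  swept-clear j b M d x y (u ∷ us) = cong (_ ∷_) (swept-clear j _ M d x y us)

  positive : ℕ → Bool
  positive zero    = false
  positive (suc _) = true

  in₁ in₂ : Cell → Bool
  in₁ (_ , _ , x , _) = proj₁ x
  in₂ (_ , _ , x , _) = proj₂ x

  found-positive : ∀ b x N → ((b ∨ x) ∨ positive N) ≡ (b ∨ positive ((if x then suc else id) N))
  found-positive true  x     N = refl
  found-positive false true  N = refl
  found-positive false false N = refl

  final-cancel : ∀ b₁ b₂ cs →
    final cancel (b₁ , b₂) cs ≡ (b₁ ∨ positive (count in₁ cs) , b₂ ∨ positive (count in₂ cs))
  final-cancel b₁    b₂    (c ∷ cs) = trans (final-cancel (b₁ ∨ in₁ c) (b₂ ∨ in₂ c) cs)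
    (cong₂ _,_ (found-positive b₁ (in₁ c) (count in₁ cs)) (found-positive b₂ (in₂ c) (count in₂ cs)))
  final-cancel true  true  []       = refl
  final-cancel true  false []       = refl
  final-cancel false true  []       = refl
  final-cancel false false []       = refl

  -- `found` means that the one member to be deleted was met further to the left.
  remaining : Bool → ℕ → ℕ
  remaining found N = if found then N else pred N

  remaining-∷ : ∀ b x N → (if b ∧ x then suc else id) (remaining (b ∨ x) N)
                          ≡ remaining b ((if x then suc else id) N)
  remaining-∷ true  x     N = refl
  remaining-∷ false true  N = refl
  remaining-∷ false false N = refl

  count₁-cancel : ∀ b₁ b₂ cs → count in₁ (swept cancel (b₁ , b₂) cs) ≡ remaining b₁ (count in₁ cs)
  count₁-cancel true  b₂ []       = refl
  count₁-cancel false b₂ []       = refl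
  count₁-cancel b₁    b₂ (c ∷ cs)
    rewrite count₁-cancel (b₁ ∨ in₁ c) (b₂ ∨ in₂ c) cs = remaining-∷ b₁ (in₁ c) (count in₁ cs)

  count₂-cancel : ∀ b₁ b₂ cs → count in₂ (swept cancel (b₁ , b₂) cs) ≡ remaining b₂ (count in₂ cs)
  count₂-cancel b₁ true  []       = refl
  count₂-cancel b₁ false []       = refl
  count₂-cancel b₁ b₂    (c ∷ cs)
    rewrite count₂-cancel (b₁ ∨ in₁ c) (b₂ ∨ in₂ c) cs = remaining-∷ b₂ (in₂ c) (count in₂ cs)

  marksOf : Cell → Vec Bool m
  marksOf (ms , _) = ms

  marks-cancel : ∀ b cs → map marksOf (swept cancel b cs) ≡ map marksOf cs
  marks-cancel b []       = refl
  marks-cancel b (c ∷ cs) = cong (marksOf c ∷_) (marks-cancel _ cs)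

  okay : Cell → Bool
  okay (_ , _ , _ , y) = proj₁ y ∧ proj₂ y

  bad-∨ : ∀ b o a → ((b ∨ not o) ∨ not a) ≡ (b ∨ not (o ∧ a))
  bad-∨ true  o     a = refl
  bad-∨ false true  a = refl
  bad-∨ false false a = refl

  final-clear : ∀ j b cs → proj₁ (final (clear j) b cs) ≡ (proj₁ b ∨ not (all okay cs))
  final-clear j (true  , _) []       = refl
  final-clear j (false , _) []       = refl
  final-clear j b           (c ∷ cs) =
    trans (final-clear j _ cs) (bad-∨ (proj₁ b) (okay c) (all okay cs))

  -- Each cell of the track i is overwritten, so that nothing needs to be
  -- known about the bits behind the pointer.
  module _ (i : Fin m) where

    swept-advanced : ∀ {n} (f : Fin n → Vec Bool m) cs → map marksOf cs ≡ tabulate f →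
      swept (advance i) tr cs ≡ tabulate (λ u → blankCell (f u [ i ]≔ false))
    swept-advanced {zero}  f []       eq = refl
    swept-advanced {suc n} f (c ∷ cs) eq with refl , eq′ ← ∷-injective eq =
      cong (_ ∷_) (swept-advanced (f ∘ suc) cs eq′)

    swept-carry : ∀ {n} (f : Fin n → Vec Bool m) cs → map marksOf cs ≡ tabulate f →
      swept (advance i) (true , false) cs ≡ tabulate (λ u → blankCell (f u [ i ]≔ (toℕ u ≡ᵇ 0)))
    swept-carry {zero}  f []       eq = refl
    swept-carry {suc n} f (c ∷ cs) eq with refl , eq′ ← ∷-injective eq =
      cong (_ ∷_) (swept-advanced (f ∘ suc) cs eq′)

    -- Every `q` at least `n` is represented by a track without marks. The position `q` is therefore
    -- arbitrary here, and moving from `n - 1` to `n` simply loses the mark.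
    swept-advance : ∀ {n} q (f : Fin n → Vec Bool m) cs → map marksOf cs ≡ tabulate f →
      (∀ u → lookup (f u) i ≡ (toℕ u ≡ᵇ q)) →
      swept (advance i) ff cs ≡ tabulate (λ u → blankCell (f u [ i ]≔ (toℕ u ≡ᵇ suc q)))
    swept-advance {zero}  q       f []       eq h = refl
    swept-advance {suc n} q       f (c ∷ cs) eq h with refl , eq′ ← ∷-injective eq
      with lookup (proj₁ c) i | h zero
    swept-advance {suc n} zero    f (c ∷ cs) eq h | true  | _ = cong (_ ∷_) (swept-carry (f ∘ suc) cs eq′)
    swept-advance {suc n} (suc q) f (c ∷ cs) eq h | false | _ = cong (_ ∷_) (swept-advance q (f ∘ suc) cs eq′ (h ∘ suc))

    final-advanced : ∀ b cs → proj₁ (final (advance i) (true , b) cs) ≡ true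
    final-advanced b []       = refl
    final-advanced b (c ∷ cs) = final-advanced true cs

    -- The sweep reports whether it found a mark, not whether it placed one. Hence the move to
    -- position `n` still succeeds, and a track has `n + 1` positions before it overflows.
    final-advance : ∀ {n} q (f : Fin n → Vec Bool m) cs → map marksOf cs ≡ tabulate f →
      (∀ u → lookup (f u) i ≡ (toℕ u ≡ᵇ q)) → proj₁ (final (advance i) ff cs) ≡ (q <ᵇ n)
    final-advance {zero}  q       f []       eq h = refl
    final-advance {suc n} q       f (c ∷ cs) eq h with refl , eq′ ← ∷-injective eq
      with lookup (proj₁ c) i | h zero
    final-advance {suc n} zero    f (c ∷ cs) eq h | true  | _ = final-advanced false cs
    final-advance {suc n} (suc q) f (c ∷ cs) eq h | false | _ = final-advance q (f ∘ suc) cs eq′ (h ∘ suc)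

    swept-resetting : ∀ {n} b (f : Fin n → Vec Bool m) cs → map marksOf cs ≡ tabulate f →
      swept (reset i) (true , b) cs ≡ tabulate (λ u → blankCell (f u [ i ]≔ false))
    swept-resetting {zero}  b f []       eq = refl
    swept-resetting {suc n} b f (c ∷ cs) eq with refl , eq′ ← ∷-injective eq =
      cong (_ ∷_) (swept-resetting b (f ∘ suc) cs eq′)

    swept-reset : ∀ {n} (f : Fin n → Vec Bool m) cs → map marksOf cs ≡ tabulate f →
      swept (reset i) ff cs ≡ tabulate (λ u → blankCell (f u [ i ]≔ (toℕ u ≡ᵇ 0)))
    swept-reset {zero}  f []       eq = refl
    swept-reset {suc n} f (c ∷ cs) eq with refl , eq′ ← ∷-injective eq =
      cong (_ ∷_) (swept-resetting false (f ∘ suc) cs eq′)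

  -- Initialisation of the work tape

  init-begin : ∀ w → TuringMachine.initial machine w ⟶⟨ 2 ⟩ (goto init₂ , unseen inj₁ [] w ∷ work [] [] ∷ [])
  init-begin []      = go (go stop)
  init-begin (a ∷ w) = go (go stop)

  init-header-run : ∀ k t ls xs →
    (goto init₂ , unseen inj₁ ls (replicate k 𝟏 ++ ♯ ∷ xs) ∷ t ∷ []) ⟶⟨ suc k ⟩
    (goto (init₃ true) , unseen inj₁ (♯ ∷ (replicate k 𝟏 ʳ++ ls)) xs ∷ t ∷ [])
  init-header-run zero    t ls xs = move refl (unseen-right inj₁ ls ♯ xs) refl stop
  init-header-run (suc k) t ls xs = move refl (unseen-right inj₁ ls 𝟏 _) refl (init-header-run k t (𝟏 ∷ ls) xs)

  firstCells : ∀ {A : Set} → Bool → List A → List Cell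
  firstCells first []       = []
  firstCells first (u ∷ us) = firstMark first ∷ firstCells false us

  init-row-run : ∀ {A : Set} first (e : A → Bool) us ls ms xs →
    (goto (init₃ first) , unseen inj₁ ls (map (λ u → letter (e u)) us ++ ♯ ∷ xs) ∷ work ms [] ∷ []) ⟶⟨ suc (length us) ⟩
    (goto init₄ , unseen inj₁ (♯ ∷ (map (λ u → letter (e u)) us ʳ++ ls)) xs ∷ work (firstCells first us ʳ++ ms) [] ∷ [])
  init-row-run first e []       ls ms xs = move refl (unseen-right inj₁ ls ♯ xs) refl stop
  init-row-run first e (u ∷ us) ls ms xs with e u
  ... | true  = move refl (unseen-right inj₁ ls 𝟏 _) refl (init-row-run false e us (𝟏 ∷ ls) (firstMark first ∷ ms) xs)
  ... | false = move refl (unseen-right inj₁ ls 𝟎 _) refl (init-row-run false e us (𝟎 ∷ ls) (firstMark first ∷ ms) xs)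

  init-end-run : ∀ t ls xs →
    (goto init₄ , unseen inj₁ ls xs ∷ t ∷ []) ⟶⟨ suc (length xs) ⟩
    (goto (inputBack (clear 0F)) , leftOf inj₁ (xs ʳ++ ls) [] ∷ t ∷ [])
  init-end-run t ls []       = move refl (at-left inj₁ ls []) refl stop
  init-end-run t ls (x ∷ xs) = move refl (unseen-right inj₁ ls x xs) refl (init-end-run t (x ∷ ls) xs)

  -- All tracks start at position 0, so exactly the first cell is marked; the right side is this
  -- position vector in the form used by the enumeration.
  firstCells-marks : ∀ n → firstCells true (allFin n) ≡
    map (λ u → blankCell (Vec.map (toℕ u ≡ᵇ_) (Vec.replicate m 0))) (allFin n)
  firstCells-marks zero    = refl
  firstCells-marks (suc n) =
    cong₂ _∷_ (cong blankCell (sym (Vec.map-replicate (0 ≡ᵇ_) 0 m))) (others Fin.suc (λ _ → refl))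
    where
    others : ∀ {k} (f : Fin k → Fin (suc n)) → (∀ u → (toℕ (f u) ≡ᵇ 0) ≡ false) →
      firstCells false (tabulate f) ≡ map (λ u → blankCell (Vec.map (toℕ u ≡ᵇ_) (Vec.replicate m 0))) (tabulate f)
    others {zero}  f h = refl
    others {suc k} f h = cong₂ _∷_
      (cong blankCell (sym (trans (Vec.map-replicate (toℕ (f zero) ≡ᵇ_) 0 m) (cong (Vec.replicate m) (h zero)))))
      (others (f ∘ suc) (h ∘ suc))

  -- Complete passes over the input

  module Blocks {n : ℕ} (k : Fin n → ℕ) (e : Fin n → Fin n → Bool) where

    code : Fin n → Word
    code v = replicate (k v) 𝟏 ++ ♯ ∷ map (λ u → letter (e v u)) (allFin n) ++ ♯ ∷ []

    word : Word
    word = concatMap code (allFin n)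

    nbrs : Pass → (Fin n → Cell) → Fin n → Two
    nbrs p C v = hits false (e v) (proj₁ ∘ inspected p ∘ C) (allFin n)
               , hits false (e v) (proj₂ ∘ inspected p ∘ C) (allFin n)

    processed : Pass → (Fin n → Cell) → Fin n → Cell
    processed p C v = write p (inS (k v)) (nbrs p C v) (C v)

    code-++ : ∀ v xs → code v ++ xs ≡
      replicate (k v) 𝟏 ++ ♯ ∷ map (λ u → letter (e v u)) (allFin n) ++ ♯ ∷ xs
    code-++ v xs = trans (++-assoc (replicate (k v) 𝟏) _ xs)
      (cong (λ z → replicate (k v) 𝟏 ++ ♯ ∷ z) (++-assoc (map (λ u → letter (e v u)) (allFin n)) _ xs))

    code-ʳ++ : ∀ v ls → ♯ ∷ (map (λ u → letter (e v u)) (allFin n) ʳ++ ♯ ∷ (replicate (k v) 𝟏 ʳ++ ls)) ≡ code v ʳ++ ls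
    code-ʳ++ v ls = sym (trans (++-ʳ++ (replicate (k v) 𝟏)) (++-ʳ++ (map (λ u → letter (e v u)) (allFin n))))

    code-length : ∀ v → suc (k v) ≤ length (code v)
    code-length v = begin
      suc (k v)                                     ≡⟨ +-comm 1 (k v) ⟩
      k v + 1                                       ≤⟨ +-mono-≤ (≤-reflexive (sym (length-replicate (k v)))) (s≤s z≤n) ⟩
      length (replicate (k v) 𝟏) + suc (length (map (λ u → letter (e v u)) (allFin n) ++ ♯ ∷ []))
                                                    ≡⟨ length-++ (replicate (k v) 𝟏) ⟨
      length (code v)                               ∎
      where open ≤-Reasoning

    -- The sweep that updates the cell of v and the row of v each cross the
    -- work tape twice.
    block-run : ∀ p v ls xs cs cs′ → length cs ≡ n →
      swept (update p (inS (k v)) (gather p ff (e v) (allFin n) cs)) ff cs ≡ cs′ →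
      (goto (header p) , inp ls (code v ++ xs) ∷ work [] cs ∷ []) ⟶⟨ length (code v) + 4 * suc n ⟩
      (goto (header p) , inp (code v ʳ++ ls) xs ∷ work [] cs′ ∷ [])
    block-run p v ls xs cs cs′ refl refl rewrite code-++ v xs | sym (code-ʳ++ v ls) =
      weaken (+-mono-≤ (code-length v) (≤-reflexive (sym four)))
       (header-run p (k v) _ ls _
        ⟫ row-run p (inS (k v)) ff (e v) (allFin n) cs _ [] xs (length-tabulate id)
        ⟫ subst₂ (λ a zs → (goto (back (sweep o)) , t ∷ workLeft (cs ʳ++ []) [] ∷ []) ⟶⟨ suc a ⟩
                           (goto (scan o ff) , t ∷ work [] zs ∷ []))
            (trans (length-ʳ++ cs) (+-identityʳ _))
            (trans (ʳ++-ʳ++ cs) (++-identityʳ _))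
            (back-run (sweep o) t (cs ʳ++ []) [])
        ⟫ scan-back-run o ff t cs (pass p) refl)
      where
      o = update p (inS (k v)) (gather p ff (e v) (allFin n) cs)
      t = inp (♯ ∷ (map (λ u → letter (e v u)) (allFin n) ʳ++ ♯ ∷ (replicate (k v) 𝟏 ʳ++ ls))) xs
      four : 4 * suc (length cs) ≡ suc (length cs) + (suc (length cs) + (suc (length cs) + suc (length cs)))
      four = cong (λ z → suc (length cs) + (suc (length cs) + (suc (length cs) + z))) (+-identityʳ _)

    -- Here `a` is the length of the input still to be read and `b` the number of vertices in it;
    -- the last summand pays for turning round and rewinding the input.
    passTime : ℕ → ℕ → ℕ
    passTime a b = a + b * (4 * suc n) + suc (suc (length word))

    -- Loop invariant: the cells of `us` have their final values, those of `vs` are untouched, and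
    -- `ls` is the reversed input read so far. The values in `processed` refer to the original cells
    -- `C` throughout.
    blocks-run : ∀ p (C : Fin n → Cell) us vs ls → (∀ v → isDone (C v) ≡ false) →
      allFin n ≡ us ++ vs → ls ʳ++ concatMap code vs ≡ word →
      (goto (header p) , inp ls (concatMap code vs) ∷ work [] (map (processed p C) us ++ map C vs) ∷ [])
        ⟶⟨ passTime (length (concatMap code vs)) (length vs) ⟩
      (goto (scan (afterPass p) ff) , inp [] word ∷ work [] (map (processed p C) (allFin n)) ∷ [])
    blocks-run p C us [] ls nd all eq =
      move refl (at-left inj₁ ls []) refl
       (subst₂ (λ a zs → (goto (inputBack (afterPass p)) , leftOf inj₁ ls [] ∷ work [] (map (processed p C) us ++ []) ∷ []) ⟶⟨ a ⟩
                         (goto (scan (afterPass p) ff) , inp [] (proj₁ zs) ∷ work [] (proj₂ zs) ∷ []))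
         (cong suc (trans (sym (trans (length-ʳ++ ls) (+-identityʳ _))) (cong length eq)))
         (cong₂ _,_ eq (trans (++-identityʳ _) (cong (map (processed p C)) (trans (sym (++-identityʳ us)) (sym all)))))
         (inputBack-run (afterPass p) _ ls []))
    blocks-run p C us (v ∷ vs) ls nd all eq =
      weaken time
       (block-run p v ls (concatMap code vs) _ _ len refl
        ⟫ subst (λ zs → (goto (header p) , inp (code v ʳ++ ls) (concatMap code vs) ∷ work [] zs ∷ []) ⟶⟨ _ ⟩ goal)
            (sym cells)
            (blocks-run p C (us ++ v ∷ []) vs (code v ʳ++ ls) nd
              (trans all (sym (∷ʳ-++ us v vs))) (trans (ʳ++-ʳ++ (code v)) eq)))
      where
      goal : Config
      goal = (goto (scan (afterPass p) ff) , inp [] word ∷ work [] (map (processed p C) (allFin n)) ∷ [])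
      cs = map (processed p C) us ++ map C (v ∷ vs)
      len : length cs ≡ n
      len = begin
        length cs                                           ≡⟨ length-++ (map (processed p C) us) ⟩
        length (map (processed p C) us) + length (map C (v ∷ vs)) ≡⟨ cong₂ _+_ (length-map (processed p C) us) (length-map C (v ∷ vs)) ⟩
        length us + length (v ∷ vs)                         ≡⟨ length-++ us ⟨
        length (us ++ v ∷ vs)                               ≡⟨ cong length all ⟨
        length (allFin n)                                   ≡⟨ length-tabulate id ⟩
        n                                                   ∎
        where open ≡-Reasoning
      gathered : gather p ff (e v) (allFin n) cs ≡ nbrs p C v
      gathered = begin
        gather p ff (e v) (allFin n) cs     ≡⟨ cong (λ z → gather p ff (e v) z cs) all ⟩
        gather p ff (e v) (us ++ v ∷ vs) cs ≡⟨ gather-processed p ff (e v) C (processed p C) us (v ∷ vs)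
                                                 (λ u → write-inspected p (inS (k u)) (nbrs p C u) (C u)) ⟩
        gather p ff (e v) (us ++ v ∷ vs) (map C (us ++ v ∷ vs)) ≡⟨ cong (λ z → gather p ff (e v) z (map C z)) all ⟨
        gather p ff (e v) (allFin n) (map C (allFin n))         ≡⟨ gather-hits p false false (e v) C (allFin n) ⟩
        nbrs p C v ∎
        where open ≡-Reasoning
      cells : swept (update p (inS (k v)) (gather p ff (e v) (allFin n) cs)) ff cs
              ≡ map (processed p C) (us ++ v ∷ []) ++ map C vs
      cells rewrite gathered =
        trans (swept-update p (inS (k v)) (nbrs p C v) (processed p C) us (C v) (map C vs)
                (λ u → write-isDone p (inS (k u)) (nbrs p C u) (C u)) (nd v))
          (sym (trans (cong (_++ map C vs) (map-++ (processed p C) us (v ∷ [])))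
                      (++-assoc (map (processed p C) us) _ _)))
      time : length (code v) + 4 * suc n + passTime (length (concatMap code vs)) (length vs)
             ≤ passTime (length (concatMap code (v ∷ vs))) (length (v ∷ vs))
      time = ≤-reflexive (begin
        a + b + (c + d + f)     ≡⟨ +-assoc (a + b) (c + d) f ⟨
        a + b + (c + d) + f     ≡⟨ cong (_+ f) (interchange a b c d) ⟩
        a + c + (b + d) + f     ≡⟨ cong (λ z → z + (b + d) + f) (length-++ (code v)) ⟨
        length (code v ++ concatMap code vs) + (b + d) + f ∎)
        where
        open ≡-Reasoning
        open import Algebra.Properties.CommutativeSemigroup +-commutativeSemigroup using (interchange)
        a = length (code v)
        b = 4 * suc n
        c = length (concatMap code vs)
        d = length vs * (4 * suc n)
        f = suc (suc (length word))

    pass-run : ∀ p (C : Fin n → Cell) → (∀ v → isDone (C v) ≡ false) →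
      (goto (header p) , inp [] word ∷ work [] (map C (allFin n)) ∷ []) ⟶⟨ passTime (length word) n ⟩
      (goto (scan (afterPass p) ff) , inp [] word ∷ work [] (map (processed p C) (allFin n)) ∷ [])
    pass-run p C nd =
      subst (λ z → (goto (header p) , inp [] word ∷ work [] (map C (allFin n)) ∷ []) ⟶⟨ passTime (length word) z ⟩
                   (goto (scan (afterPass p) ff) , inp [] word ∷ work [] (map (processed p C) (allFin n)) ∷ []))
        {x = length (allFin n)} {y = n} (length-tabulate id) (blocks-run p C [] (allFin n) [] nd refl refl)

    -- Testing one pair of candidate sets

    length-word : ∀ vs → length vs ≤ length (concatMap code vs)
    length-word []       = z≤n
    length-word (v ∷ vs) = begin
      suc (length vs)                                  ≤⟨ +-mono-≤ (≤-trans (s≤s z≤n) (code-length v)) (length-word vs) ⟩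
      length (code v) + length (concatMap code vs)     ≡⟨ length-++ (code v) ⟨
      length (code v ++ concatMap code vs)             ∎
      where open ≤-Reasoning

    -- Bounds both a sweep of the work tape and a rewind of the input, so that all later bounds
    -- depend on the input length alone.
    width : ℕ
    width = suc (length word)

    n<width : suc n ≤ width
    n<width = s≤s (subst (_≤ length word) (length-tabulate {n = n} id) (length-word (allFin n)))

    home : (Fin n → Vec Bool m) → Config
    home M = goto (header compute) , inp [] word ∷ work [] (map (blankCell ∘ M) (allFin n)) ∷ []

    candidates : (Fin n → Vec Bool m) → Fin n → Two
    candidates M u = chosen (M u) ∨² both (inS (k u)) ∧² not² (nbrs compute (blankCell ∘ M) u)

    withCandidates : (Fin n → Vec Bool m) → Fin n → Cell
    withCandidates M u = M u , false , candidates M u , ff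

    compatible : (Fin n → Vec Bool m) → Fin n → Two
    compatible M u = candidates M u xor² nbrs verify (withCandidates M) u

    verified : (Fin n → Vec Bool m) → Fin n → Cell
    verified M u = M u , false , candidates M u , compatible M u

    -- The premise is the outcome of verification: both candidates are maximal independent sets.
    Good : (Fin n → Vec Bool m) → Set
    Good M = all (okay ∘ verified M) (allFin n) ≡ true →
             count (λ u → proj₁ (candidates M u)) (allFin n) ≡ count (λ u → proj₂ (candidates M u)) (allFin n)

    -- The final tape is described only up to its tracks, since the next advance sweep resets all
    -- other bits.
    Arrives : ℕ → Config → Fin (suc m) → (Fin n → Vec Bool m) → Set
    Arrives t c i M = ∃[ cs ] map marksOf cs ≡ map M (allFin n) ×
      c ⟶⟨ t ⟩ (next-track i , inp [] word ∷ workLeft (cs ʳ++ []) [] ∷ [])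

    Rejects : ℕ → Config → Set
    Rejects t c = ∃[ ts ] c ⟶⟨ t ⟩ (halt false , ts)

    length-marks : ∀ {cs} (M : Fin n → Vec Bool m) → map marksOf cs ≡ map M (allFin n) → length cs ≡ n
    length-marks {cs} M eq = begin
      length cs                   ≡⟨ length-map marksOf cs ⟨
      length (map marksOf cs)       ≡⟨ cong length eq ⟩
      length (map M (allFin n))   ≡⟨ length-map M (allFin n) ⟩
      length (allFin n)           ≡⟨ length-tabulate id ⟩
      n                           ∎
      where open ≡-Reasoning

    sweep-run : ∀ o b cs τ → length cs ≡ n → decide o (final o b cs) ≡ goto (back τ) →
      (goto (scan o b) , inp [] word ∷ work [] cs ∷ []) ⟶⟨ width + width ⟩
      (goto (resume τ) , inp [] word ∷ work [] (swept o b cs) ∷ [])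
    sweep-run o b cs τ refl eq = weaken (+-mono-≤ n<width n<width) (scan-back-run o b _ cs τ eq)

    last-sweep-run : ∀ o b cs → length cs ≡ n →
      (goto (scan o b) , inp [] word ∷ work [] cs ∷ []) ⟶⟨ width ⟩
      (decide o (final o b cs) , inp [] word ∷ workLeft (swept o b cs ʳ++ []) [] ∷ [])
    last-sweep-run o b cs refl = weaken n<width (scan-run o b _ [] cs)

    back-to-left : ∀ τ cs → length cs ≡ n →
      (goto (back τ) , inp [] word ∷ workLeft (cs ʳ++ []) [] ∷ []) ⟶⟨ width ⟩
      (goto (resume τ) , inp [] word ∷ work [] cs ∷ [])
    back-to-left τ cs len = subst
      (λ zs → (goto (back τ) , inp [] word ∷ workLeft (cs ʳ++ []) [] ∷ []) ⟶⟨ width ⟩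
              (goto (resume τ) , inp [] word ∷ work [] zs ∷ []))
      (trans (ʳ++-ʳ++ cs) (++-identityʳ _))
      (weaken (subst (λ z → suc z ≤ width) (sym (trans (length-ʳ++ cs) (trans (+-identityʳ _) len))) n<width)
        (back-run τ (inp [] word) (cs ʳ++ []) []))

    -- Each round lowers both counts by one, so they reach zero together exactly when they were
    -- equal. A round costs one sweep and one return.
    cancel-run : ∀ a b cs M → map marksOf cs ≡ map M (allFin n) → count in₁ cs ≡ a → count in₂ cs ≡ b →
      let c = goto (scan cancel ff) , inp [] word ∷ work [] cs ∷ []
      in  (a ≡ b × Arrives (suc a * (width + width)) c (fromℕ m) M) ⊎ (a ≢ b × Rejects (suc a * (width + width)) c)
    cancel-run a b cs M eq ca cb
      with last-sweep-run cancel ff cs (length-marks M eq) | final-cancel false false cs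
    ... | r | fin rewrite fin | ca | cb with a | b
    ... | zero | zero = inj₁ (refl , swept cancel ff cs , trans (marks-cancel ff cs) eq
                             , weaken (≤-trans (m≤m+n width width) (m≤m+n _ _)) r)
    ... | zero | suc b′ = inj₂ ((λ ()) , _ , weaken (≤-trans (m≤m+n width width) (m≤m+n _ _)) r)
    ... | suc a′ | zero = inj₂ ((λ ()) , _ , weaken (≤-trans (m≤m+n width width) (m≤m+n _ _)) r)
    ... | suc a′ | suc b′
      with cancel-run a′ b′ (swept cancel ff cs) M (trans (marks-cancel ff cs) eq)
             (trans (count₁-cancel false false cs) (cong pred ca))
             (trans (count₂-cancel false false cs) (cong pred cb))
         | back-to-left (sweep cancel) (swept cancel ff cs) (trans (length-swept cancel ff cs) (length-marks M eq))
    ... | inj₁ (a≡b , cs′ , eq′ , r′) | s =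
      inj₁ (cong suc a≡b , cs′ , eq′ , weaken (≤-reflexive (sym (+-assoc width width _))) (r ⟫ s ⟫ r′))
    ... | inj₂ (a≢b , ts , r′) | s =
      inj₂ ((a≢b ∘ suc-injective) , ts , weaken (≤-reflexive (sym (+-assoc width width _))) (r ⟫ s ⟫ r′))

    passBound : ℕ → ℕ
    passBound w = w + w * (4 * w) + suc w

    pass-bounded : passTime (length word) n ≤ passBound width
    pass-bounded = +-monoˡ-≤ (suc width) (+-mono-≤ {length word} (n≤1+n _)
      (*-mono-≤ {n} (≤-trans (n≤1+n n) n<width) (*-monoʳ-≤ 4 n<width)))

    -- In order: the `compute` pass, clearing and returning, the `verify` pass, clearing, returning,
    -- and at most `w` cancel rounds.
    bodyBound : ℕ → ℕ
    bodyBound w = passBound w + ((w + w) + (passBound w + (w + (w + w * (w + w)))))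

    body-run : ∀ M → (Good M × Arrives (bodyBound width) (home M) (fromℕ m) M)
                   ⊎ (¬ Good M × Rejects (bodyBound width) (home M))
    body-run M = decided (all (okay ∘ verified M) (allFin n)) refl
      where
      cs₁ = map (processed compute (blankCell ∘ M)) (allFin n)
      cs₂ = map (processed verify (withCandidates M)) (allFin n)
      cs₃ = map (verified M) (allFin n)
      len : ∀ {A : Set} (C : Fin n → A) → length (map C (allFin n)) ≡ n
      len C = trans (length-map C (allFin n)) (length-tabulate id)
      marks₃ : map marksOf cs₃ ≡ map M (allFin n)
      marks₃ = sym (map-∘ (allFin n))
      swept₂ : swept (clear 2F) ff cs₂ ≡ cs₃
      swept₂ = swept-clear 2F ff M _ (candidates M) (compatible M) (allFin n)
      counted : ∀ (x : Cell → Bool) → count x cs₃ ≡ count (x ∘ verified M) (allFin n)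
      counted x = count-map x (verified M) (allFin n)
      final₂ : proj₁ (final (clear 2F) ff cs₂) ≡ not (all (okay ∘ verified M) (allFin n))
      final₂ = trans (final-clear 2F ff cs₂)
        (cong (not ∘ and) (sym (map-∘ (allFin n))))
      start : home M ⟶⟨ passBound width + ((width + width) + (passBound width + width)) ⟩
              (decide (clear 2F) (final (clear 2F) ff cs₂) , inp [] word ∷ workLeft (cs₃ ʳ++ []) [] ∷ [])
      start =
        weaken pass-bounded (pass-run compute (blankCell ∘ M) (λ _ → refl))
        ⟫ subst (λ zs → (goto (scan (clear 1F) ff) , inp [] word ∷ work [] cs₁ ∷ []) ⟶⟨ width + width ⟩
                        (goto (header verify) , inp [] word ∷ work [] zs ∷ []))
            (swept-clear 1F ff M _ (candidates M) (λ _ → ff) (allFin n))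
            (sweep-run (clear 1F) ff cs₁ (pass verify) (len _) refl)
        ⟫ weaken pass-bounded (pass-run verify (withCandidates M) (λ _ → refl))
        ⟫ subst (λ zs → (goto (scan (clear 2F) ff) , inp [] word ∷ work [] cs₂ ∷ []) ⟶⟨ width ⟩
                        (decide (clear 2F) (final (clear 2F) ff cs₂) , inp [] word ∷ workLeft (zs ʳ++ []) [] ∷ []))
            swept₂ (last-sweep-run (clear 2F) ff cs₂ (len _))
      first : ∀ {d} → decide (clear 2F) (final (clear 2F) ff cs₂) ≡ d →
        home M ⟶⟨ passBound width + ((width + width) + (passBound width + width)) ⟩
              (d , inp [] word ∷ workLeft (cs₃ ʳ++ []) [] ∷ [])
      first refl = start
      assoc : ∀ {x y} → x ≤ y →
              passBound width + ((width + width) + (passBound width + width)) + x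
              ≤ passBound width + ((width + width) + (passBound width + (width + y)))
      assoc {x} {y} x≤y = begin
        P + ((width + width) + (P + width)) + x     ≡⟨ +-assoc P _ x ⟩
        P + ((width + width) + (P + width) + x)     ≡⟨ cong (P +_) (+-assoc (width + width) _ x) ⟩
        P + ((width + width) + (P + width + x))     ≡⟨ cong (λ z → P + ((width + width) + z)) (+-assoc P width x) ⟩
        P + ((width + width) + (P + (width + x)))   ≤⟨ +-monoʳ-≤ P (+-monoʳ-≤ (width + width) (+-monoʳ-≤ P (+-monoʳ-≤ width x≤y))) ⟩
        P + ((width + width) + (P + (width + y)))   ∎
        where
        open ≤-Reasoning
        P = passBound width
      fewRounds : suc (count in₁ cs₃) * (width + width) ≤ width * (width + width)
      fewRounds = *-monoˡ-≤ (width + width)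
        (≤-trans (s≤s (≤-trans (count≤length in₁ cs₃) (≤-reflexive (len _)))) n<width)
      decided : ∀ b → all (okay ∘ verified M) (allFin n) ≡ b →
        (Good M × Arrives (bodyBound width) (home M) (fromℕ m) M) ⊎ (¬ Good M × Rejects (bodyBound width) (home M))
      -- Verification failed, so `Good` holds vacuously and the machine goes on.
      decided false eq = inj₁ ((λ eq′ → contradiction (trans (sym eq) eq′) λ ()) , cs₃ , marks₃ ,
        weaken (≤-trans (m≤m+n _ 0) (assoc z≤n)) (first (bad (trans final₂ (cong not eq)))))
        where
        bad : ∀ {b} → proj₁ b ≡ true → decide (clear 2F) b ≡ next-track (fromℕ m)
        bad {true , _} refl = refl
      decided true eq with cancel-run (count in₁ cs₃) (count in₂ cs₃) cs₃ M marks₃ refl refl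
                         | back-to-left (sweep cancel) cs₃ (len _) | first (good-end (trans final₂ (cong not eq)))
        where
        good-end : ∀ {b} → proj₁ b ≡ false → decide (clear 2F) b ≡ goto (back (sweep cancel))
        good-end {false , _} refl = refl
      ... | inj₁ (same , cs , marks , r) | s | f =
        inj₁ ((λ _ → trans (sym (counted in₁)) (trans same (counted in₂))) , cs , marks ,
              weaken (assoc (+-monoʳ-≤ width fewRounds)) (f ⟫ s ⟫ r))
      ... | inj₂ (differ , ts , r) | s | f =
        inj₂ ((λ good → differ (trans (counted in₁) (trans (good eq) (sym (counted in₂))))) , ts ,
              weaken (assoc (+-monoʳ-≤ width fewRounds)) (f ⟫ s ⟫ r))

    -- Enumeration of all track positions

    marks : Vec ℕ m → Fin n → Vec Bool m
    marks ps u = Vec.map (toℕ u ≡ᵇ_) ps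

    ZeroFrom : ℕ → Vec ℕ m → Set
    ZeroFrom i ps = ∀ j → i ≤ toℕ j → lookup ps j ≡ 0

    -- The value `n` is allowed and stands for a track pointing to no vertex, so that sets of fewer
    -- than `l` vertices are represented too.
    Bounded : Vec ℕ m → Set
    Bounded qs = ∀ j → lookup qs j ≤ n

    AgreeBelow : ℕ → Vec ℕ m → Vec ℕ m → Set
    AgreeBelow i qs ps = ∀ j → toℕ j < i → lookup qs j ≡ lookup ps j

    Fails : ℕ → Vec ℕ m → Set
    Fails t ps = (∃[ qs ] ¬ Good (marks qs)) × Rejects t (home (marks ps))

    -- The tracks from i on have been enumerated completely.
    Checked : Fin (suc m) → ℕ → Vec ℕ m → Set
    Checked i t ps =
      ((∀ qs → Bounded qs → AgreeBelow (toℕ i) qs ps → Good (marks qs)) × Arrives t (home (marks ps)) i (marks ps))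
      ⊎ Fails t ps

    marks-update : ∀ ps i q us → map (λ u → blankCell (marks ps u [ i ]≔ (toℕ u ≡ᵇ q))) us
                                 ≡ map (blankCell ∘ marks (ps [ i ]≔ q)) us
    marks-update ps i q us = map-cong (λ u → cong blankCell (sym (Vec.map-[]≔ (toℕ u ≡ᵇ_) ps i))) us

    map-allFin : ∀ {A : Set} (f : Fin n → A) → map f (allFin n) ≡ tabulate f
    map-allFin f = map-tabulate id f

    lookup-marks : ∀ ps i u → lookup (marks ps u) i ≡ (toℕ u ≡ᵇ lookup ps i)
    lookup-marks ps i u = Vec.lookup-map i (toℕ u ≡ᵇ_) ps

    n≮ᵇn : ∀ a → (a <ᵇ a) ≡ false
    n≮ᵇn zero    = refl
    n≮ᵇn (suc a) = n≮ᵇn a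

    n<ᵇn+suc : ∀ a b → (a <ᵇ a + suc b) ≡ true
    n<ᵇn+suc zero    b = refl
    n<ᵇn+suc (suc a) b = n<ᵇn+suc a b

    module _ (ps : Vec ℕ m) (i : Fin m) (cs : List Cell) (eq : map marksOf cs ≡ map (marks ps) (allFin n)) where

      private
        eq′ : map marksOf cs ≡ tabulate (marks ps)
        eq′ = trans eq (map-allFin (marks ps))

        len : length cs ≡ n
        len = length-marks (marks ps) eq

        advanced : List Cell
        advanced = swept (advance i) ff cs

        advanced≡ : advanced ≡ map (blankCell ∘ marks (ps [ i ]≔ suc (lookup ps i))) (allFin n)
        advanced≡ = trans (swept-advance i (lookup ps i) (marks ps) cs eq′ (lookup-marks ps i))
          (trans (sym (map-allFin _)) (marks-update ps i _ (allFin n)))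

      -- The equation with `suc r` says that the position is below `n`, so the sweep finds a mark to
      -- move, possibly off the tape.
      advance-run : ∀ r → lookup ps i + suc r ≡ n →
        (goto (back (sweep (advance i))) , inp [] word ∷ workLeft (cs ʳ++ []) [] ∷ []) ⟶⟨ width + (width + width) ⟩
        home (marks (ps [ i ]≔ suc (lookup ps i)))
      advance-run r q+r≡n =
        back-to-left (sweep (advance i)) cs len
        ⟫ subst (λ zs → (goto (scan (advance i) ff) , inp [] word ∷ work [] cs ∷ []) ⟶⟨ width + width ⟩
                        (goto (header compute) , inp [] word ∷ work [] zs ∷ []))
            advanced≡ (sweep-run (advance i) ff cs (pass compute) len
              (moved (trans (final-advance i (lookup ps i) (marks ps) cs eq′ (lookup-marks ps i))
                            (trans (cong (lookup ps i <ᵇ_) (sym q+r≡n)) (n<ᵇn+suc (lookup ps i) r)))))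
        where
        moved : ∀ {b} → proj₁ b ≡ true → decide (advance i) b ≡ goto (back (pass compute))
        moved {true , _} refl = refl

      reset-run : lookup ps i ≡ n →
        Arrives (width + ((width + width) + width)) (goto (back (sweep (advance i))) , inp [] word ∷ workLeft (cs ʳ++ []) [] ∷ [])
          (inject₁ i) (marks (ps [ i ]≔ 0))
      reset-run q≡n = swept (reset i) ff advanced , marks≡ ,
        (back-to-left (sweep (advance i)) cs len
         ⟫ sweep-run (advance i) ff cs (sweep (reset i)) len
             (overflow (trans (final-advance i (lookup ps i) (marks ps) cs eq′ (lookup-marks ps i))
                              (trans (cong (lookup ps i <ᵇ_) (sym q≡n)) (n≮ᵇn (lookup ps i)))))
         ⟫ last-sweep-run (reset i) ff advanced (trans (length-swept (advance i) ff cs) len))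
        where
        overflow : ∀ {b} → proj₁ b ≡ false → decide (advance i) b ≡ goto (back (sweep (reset i)))
        overflow {false , _} refl = refl
        -- The failed advance formally leaves the track at position `n + 1`, again without marks;
        -- the reset overwrites it.
        ps′ = ps [ i ]≔ suc (lookup ps i)
        marks≡ : map marksOf (swept (reset i) ff advanced) ≡ map (marks (ps [ i ]≔ 0)) (allFin n)
        marks≡ = begin
          map marksOf (swept (reset i) ff advanced)
            ≡⟨ cong (map marksOf) (swept-reset i (marks ps′) advanced
                 (trans (cong (map marksOf) advanced≡) (trans (sym (map-∘ (allFin n))) (map-allFin (marks ps′))))) ⟩
          map marksOf (tabulate (λ u → blankCell (marks ps′ u [ i ]≔ (toℕ u ≡ᵇ 0))))
            ≡⟨ cong (map marksOf) (trans (sym (map-allFin _)) (marks-update ps′ i 0 (allFin n))) ⟩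
          map marksOf (map (blankCell ∘ marks (ps′ [ i ]≔ 0)) (allFin n))
            ≡⟨ map-∘ (allFin n) ⟨
          map (marks (ps′ [ i ]≔ 0)) (allFin n)
            ≡⟨ cong (λ z → map (marks z) (allFin n)) (Vec.[]≔-idempotent ps i) ⟩
          map (marks (ps [ i ]≔ 0)) (allFin n) ∎
          where open ≡-Reasoning

    -- One full enumeration of the later tracks, then a return, an advance sweep with its return,
    -- and possibly a reset sweep.
    roundBound : ℕ → ℕ → ℕ
    roundBound w t = t + (w + ((w + w) + w))

    module _ (i : Fin m) (t : ℕ) (inner : ∀ ps → ZeroFrom (suc (toℕ i)) ps → Checked (suc i) t ps) where

      private
        round : ℕ
        round = roundBound width t

        round-bound : ∀ x → t + (width + (width + width) + x) ≤ round + x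
        round-bound x = ≤-trans (≤-reflexive (sym (+-assoc t _ _)))
          (+-monoˡ-≤ x (+-monoʳ-≤ t (+-monoʳ-≤ width (m≤m+n (width + width) width))))

        arrive-weaken : ∀ {s s′ c j M} → s ≤ s′ → Arrives s c j M → Arrives s′ c j M
        arrive-weaken s≤s′ (cs , eq , r) = cs , eq , weaken s≤s′ r

        agree-suc : ∀ {qs ps : Vec ℕ m} → AgreeBelow (toℕ i) qs ps → lookup qs i ≡ lookup ps i →
                    AgreeBelow (suc (toℕ i)) qs ps
        agree-suc {qs} {ps} below same j (s≤s j≤i) with m≤n⇒m<n∨m≡n j≤i
        ... | inj₁ j<i = below j j<i
        ... | inj₂ j≡i = subst (λ z → lookup qs z ≡ lookup ps z) (sym (toℕ-injective j≡i)) same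

        other : ∀ (ps : Vec ℕ m) q j → toℕ j ≢ toℕ i → lookup (ps [ i ]≔ q) j ≡ lookup ps j
        other ps q j j≢i = Vec.lookup∘updateAt′ j i (j≢i ∘ cong toℕ) ps

      -- Induction on the number `r` of positions of track `i` still to come. At each position
      -- `inner` exhausts the later tracks and brings them back to 0, so it applies again after the
      -- advance.
      enumerate : ∀ r ps → ZeroFrom (suc (toℕ i)) ps → lookup ps i + r ≡ n →
        ((∀ qs → Bounded qs → AgreeBelow (toℕ i) qs ps → lookup ps i ≤ lookup qs i → Good (marks qs))
          × Arrives (suc r * round) (home (marks ps)) (inject₁ i) (marks (ps [ i ]≔ 0)))
        ⊎ Fails (suc r * round) ps
      enumerate r ps zeros q+r≡n with inner ps zeros
      enumerate r ps zeros q+r≡n | inj₂ (bad , ts , run) =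
        inj₂ (bad , ts , weaken (≤-trans (m≤m+n t _) (m≤m+n round _)) run)
      enumerate zero ps zeros q+r≡n | inj₁ (good , cs , eq , run) =
        let cs′ , eq′ , run′ = reset-run ps i cs eq q≡n
        -- At the last position, `n`, boundedness forces `qs` to agree with `ps` on track `i` as
        -- well.
        in inj₁ ((λ qs bd below q≤ → good qs bd (agree-suc {qs} {ps} below
                    (≤-antisym (subst (lookup qs i ≤_) (sym q≡n) (bd i)) q≤)))
                , cs′ , eq′ , weaken (m≤m+n round _) (run ⟫ run′))
        where
        q≡n : lookup ps i ≡ n
        q≡n = trans (sym (+-identityʳ _)) q+r≡n
      enumerate (suc r) ps zeros q+r≡n | inj₁ (good , cs , eq , run)
        with enumerate r (ps [ i ]≔ suc (lookup ps i))
               (λ j i<j → trans (other ps (suc (lookup ps i)) j (>⇒≢ i<j)) (zeros j i<j))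
               (trans (cong (_+ r) (Vec.lookup∘updateAt i ps)) (trans (sym (+-suc (lookup ps i) r)) q+r≡n))
      ... | inj₂ (bad , ts , run′) =
        inj₂ (bad , ts , weaken (round-bound (suc r * round)) (run ⟫ advance-run ps i cs eq r q+r≡n ⟫ run′))
      ... | inj₁ (good′ , cs′ , eq′ , run′) =
        inj₁ (all-good , cs′ , trans eq′ (cong (λ z → map (marks z) (allFin n)) (Vec.[]≔-idempotent ps i)) ,
              weaken (round-bound (suc r * round)) (run ⟫ advance-run ps i cs eq r q+r≡n ⟫ run′))
        where
        all-good : ∀ qs → Bounded qs → AgreeBelow (toℕ i) qs ps → lookup ps i ≤ lookup qs i → Good (marks qs)
        all-good qs bd below q≤ with m≤n⇒m<n∨m≡n q≤
        ... | inj₁ q< = good′ qs bd (λ j j<i → trans (below j j<i) (sym (other ps (suc (lookup ps i)) j (<⇒≢ j<i))))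
                          (subst (_≤ lookup qs i) (sym (Vec.lookup∘updateAt i ps)) q<)
        ... | inj₂ q≡ = good qs bd (agree-suc {qs} {ps} below (sym q≡))

      check-track : ∀ ps → ZeroFrom (toℕ (inject₁ i)) ps → Checked (inject₁ i) (width * round) ps
      check-track ps zeros with enumerate n ps (λ j i<j → zeros j (≤-trans (≤-reflexive (toℕ-inject₁ i)) (<⇒≤ i<j))) (cong (_+ n) zeroᵢ)
        where
        zeroᵢ : lookup ps i ≡ 0
        zeroᵢ = zeros i (≤-reflexive (toℕ-inject₁ i))
      ... | inj₂ (bad , ts , run) = inj₂ (bad , ts , weaken (*-monoˡ-≤ round n<width) run)
      ... | inj₁ (good , arrives) =
        inj₁ ((λ qs bd below → good qs bd
                 (λ j j<i → below j (subst (toℕ j <_) (sym (toℕ-inject₁ i)) j<i))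
                 (subst (_≤ lookup qs i) (sym zeroᵢ) z≤n))
             -- The track started at 0, so resetting it restores `ps` itself.
             , subst (λ z → Arrives (width * round) (home (marks ps)) (inject₁ i) (marks z))
                 (trans (cong (λ q → ps [ i ]≔ q) (sym zeroᵢ)) (Vec.[]≔-lookup ps i))
                 (arrive-weaken (*-monoˡ-≤ round n<width) arrives))
        where
        zeroᵢ : lookup ps i ≡ 0
        zeroᵢ = zeros i (≤-reflexive (toℕ-inject₁ i))

    -- Base of the enumeration: agreement on all `m` tracks leaves `ps` as the only vector, which is
    -- a single test.
    check-body : ∀ ps → Checked (fromℕ m) (bodyBound width) ps
    check-body ps with body-run (marks ps)
    ... | inj₂ (bad , rejects) = inj₂ ((ps , bad) , rejects)
    ... | inj₁ (good , arrives) = inj₁ ((λ qs _ agree → subst (Good ∘ marks) (sym (same qs agree)) good) , arrives)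
      where
      same : ∀ qs → AgreeBelow (toℕ (fromℕ m)) qs ps → qs ≡ ps
      same qs agree = begin
        qs                        ≡⟨ Vec.tabulate∘lookup qs ⟨
        Vec.tabulate (lookup qs)  ≡⟨ Vec.tabulate-cong (λ j → agree j (subst (toℕ j <_) (sym (toℕ-fromℕ m)) (toℕ<n j))) ⟩
        Vec.tabulate (lookup ps)  ≡⟨ Vec.tabulate∘lookup ps ⟩
        ps                        ∎
        where open ≡-Reasoning

    zeros : Vec ℕ m
    zeros = Vec.replicate m 0

    -- In order: two steps to delimit the left ends, the first header, the first row, the rest of
    -- the input, the rewind, one step to turn, and the return on the work tape.
    initBound : ℕ → ℕ
    initBound w = 2 + (w + (w + (w + (w + (1 + w)))))

    init-last-run : ∀ ls ms → ls ʳ++ [] ≡ word → ms ʳ++ [] ≡ firstCells true (allFin n) →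
      (goto (inputBack (clear 0F)) , leftOf inj₁ ls [] ∷ work ms [] ∷ []) ⟶⟨ width + (1 + width) ⟩
      home (marks zeros)
    init-last-run ls ms eq eq′ =
      subst₂ (λ a w → (goto (inputBack (clear 0F)) , leftOf inj₁ ls [] ∷ work ms [] ∷ []) ⟶⟨ suc a ⟩
                      (goto (scan (clear 0F) ff) , inp [] w ∷ work ms [] ∷ []))
        (trans (sym (trans (length-ʳ++ ls) (+-identityʳ _))) (cong length eq)) eq
        (inputBack-run (clear 0F) (work ms []) ls [])
      -- The work head is still at the right end, so this sweep meets no cell and only hands over to
      -- the first pass.
      ⟫ scan-run (clear 0F) ff _ ms []
      ⟫ subst (λ zs → (goto (back (pass compute)) , inp [] word ∷ workLeft ms [] ∷ []) ⟶⟨ width ⟩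
                      (goto (header compute) , inp [] word ∷ work [] zs ∷ []))
          (trans eq′ (firstCells-marks n))
          (weaken (≤-trans (s≤s (≤-reflexive len)) n<width) (back-run (pass compute) _ ms []))
      where
      len : length ms ≡ n
      len = begin
        length ms                                        ≡⟨ +-identityʳ _ ⟨
        length ms + 0                                    ≡⟨ length-ʳ++ ms ⟨
        length (ms ʳ++ [])                               ≡⟨ cong length (trans eq′ (firstCells-marks n)) ⟩
        length (map (blankCell ∘ marks zeros) (allFin n)) ≡⟨ length-map _ (allFin n) ⟩
        length (allFin n)                                ≡⟨ length-tabulate id ⟩
        n                                                ∎
        where open ≡-Reasoning

    -- A row has one letter per vertex, so the first row provides the right number of cells; the
    -- remaining input is crossed only to delimit its right end. Without vertices the input is blank
    -- and `init₂` rewinds at once.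
    init-run : TuringMachine.initial machine word ⟶⟨ initBound width ⟩ home (marks zeros)
    init-run = from (allFin n) refl
      where
      from : ∀ vs → allFin n ≡ vs → TuringMachine.initial machine word ⟶⟨ initBound width ⟩ home (marks zeros)
      from [] eq = weaken (+-monoʳ-≤ 2 (≤-trans rest (m≤n+m _ width)))
        (subst (λ w → TuringMachine.initial machine word ⟶⟨ 2 ⟩ (goto init₂ , unseen inj₁ [] w ∷ work [] [] ∷ []))
           word≡[] (init-begin word)
         ⟫ move {t = leftOf inj₁ [] []} refl refl refl
             (init-last-run [] [] (sym word≡[]) (sym (cong (firstCells true) eq))))
        where
        word≡[] : word ≡ []
        word≡[] = cong (concatMap code) eq
        rest : 1 + (width + (1 + width)) ≤ width + (width + (width + (1 + width)))
        rest = +-mono-≤ {1} (s≤s z≤n) (m≤n+m _ width)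
      from (v ∷ vs) eq =
        init-begin word
        ⟫ subst (λ w → (goto init₂ , unseen inj₁ [] w ∷ work [] [] ∷ []) ⟶⟨ width ⟩
                       (goto (init₃ true) , unseen inj₁ (♯ ∷ (replicate (k v) 𝟏 ʳ++ [])) (R ++ ♯ ∷ xs) ∷ work [] [] ∷ []))
            (sym word≡) (weaken k<width (init-header-run (k v) _ [] _))
        ⟫ weaken (≤-trans (≤-reflexive (cong suc (length-tabulate id))) n<width) (init-row-run true (e v) (allFin n) _ [] xs)
        ⟫ weaken xs<width (init-end-run _ _ xs)
        ⟫ init-last-run (xs ʳ++ (♯ ∷ (R ʳ++ (♯ ∷ (replicate (k v) 𝟏 ʳ++ []))))) (firstCells true (allFin n) ʳ++ []) read
            (trans (ʳ++-ʳ++ (firstCells true (allFin n))) (++-identityʳ _))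
        where
        R = map (λ u → letter (e v u)) (allFin n)
        xs = concatMap code vs
        word≡′ : word ≡ code v ++ xs
        word≡′ = cong (concatMap code) eq
        word≡ : word ≡ replicate (k v) 𝟏 ++ ♯ ∷ R ++ ♯ ∷ xs
        word≡ = trans word≡′ (code-++ v xs)
        k<width : suc (k v) ≤ width
        k<width = ≤-trans (code-length v) (m≤n⇒m≤1+n (subst (length (code v) ≤_)
          (sym (trans (cong length word≡′) (length-++ (code v)))) (m≤m+n _ _)))
        xs<width : suc (length xs) ≤ width
        xs<width = s≤s (subst (length xs ≤_) (sym (trans (cong length word≡′) (length-++ (code v)))) (m≤n+m _ _))
        read : (xs ʳ++ (♯ ∷ (R ʳ++ (♯ ∷ (replicate (k v) 𝟏 ʳ++ []))))) ʳ++ [] ≡ word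
        read = begin
          (xs ʳ++ (♯ ∷ (R ʳ++ (♯ ∷ (replicate (k v) 𝟏 ʳ++ []))))) ʳ++ []
            ≡⟨ cong (λ z → (xs ʳ++ z) ʳ++ []) (code-ʳ++ v []) ⟩
          (xs ʳ++ (code v ʳ++ [])) ʳ++ []     ≡⟨ ʳ++-ʳ++ xs ⟩
          (code v ʳ++ []) ʳ++ xs ++ []        ≡⟨ ʳ++-ʳ++ (code v) ⟩
          code v ++ xs ++ []                  ≡⟨ cong (code v ++_) (++-identityʳ xs) ⟩
          code v ++ xs                        ≡⟨ word≡′ ⟨
          word                                ∎
          where open ≡-Reasoning

  -- Time bounds uniform in the instance

  CheckedUniformly : Fin (suc m) → Set
  CheckedUniformly i = ∃[ T ] Polynomial T ×
    (∀ {n} (k : Fin n → ℕ) (e : Fin n → Fin n → Bool) → let open Blocks k e in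
     ∀ ps → ZeroFrom (toℕ i) ps → Checked i (T (length word)) ps)

  widthᵖ : Polynomial suc
  widthᵖ = constantᵖ 1 +ᵖ identityᵖ

  -- Downward induction from `m` to 0. Each track contributes one more factor of the width, and the
  -- number of tracks depends only on `l`, so the bound stays polynomial.
  checked : ∀ i → CheckedUniformly i
  checked = >-weakInduction CheckedUniformly
    (_ , bodyᵖ , λ k e ps _ → Blocks.check-body k e ps)
    (λ i (T , Tᵖ , inner) →
       _ , widthᵖ *ᵖ (Tᵖ +ᵖ (widthᵖ +ᵖ ((widthᵖ +ᵖ widthᵖ) +ᵖ widthᵖ))) ,
       λ k e → Blocks.check-track k e i (T (length (Blocks.word k e))) (inner k e))
    where
    passᵖ : Polynomial (λ x → suc x + suc x * (4 * suc x) + suc (suc x))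
    passᵖ = widthᵖ +ᵖ widthᵖ *ᵖ (constantᵖ 4 *ᵖ widthᵖ) +ᵖ (constantᵖ 1 +ᵖ widthᵖ)
    bodyᵖ : Polynomial _
    bodyᵖ = passᵖ +ᵖ ((widthᵖ +ᵖ widthᵖ) +ᵖ (passᵖ +ᵖ (widthᵖ +ᵖ (widthᵖ +ᵖ widthᵖ *ᵖ (widthᵖ +ᵖ widthᵖ)))))

  Decides : Set
  Decides = ∃[ p ] ∀ {n} (k : Fin n → ℕ) (e : Fin n → Fin n → Bool) → let open Blocks k e in
    ∃[ b ] TuringMachine.HaltsWithin machine (evalPoly p (length word)) word b
           × (if b then (∀ qs → Bounded qs → Good (marks qs)) else (∃[ qs ] ¬ Good (marks qs)))

  decides-if-checked : CheckedUniformly zero → Decides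
  decides-if-checked (T , Tᵖ , check) = proj₁ totalᵖ , run
    where
    initᵖ : Polynomial (λ x → 2 + (suc x + (suc x + (suc x + (suc x + (1 + suc x))))))
    initᵖ = constantᵖ 2 +ᵖ (widthᵖ +ᵖ (widthᵖ +ᵖ (widthᵖ +ᵖ (widthᵖ +ᵖ (constantᵖ 1 +ᵖ widthᵖ)))))
    totalᵖ : Polynomial _
    totalᵖ = initᵖ +ᵖ Tᵖ
    run : ∀ {n} (k : Fin n → ℕ) (e : Fin n → Fin n → Bool) → let open Blocks k e in
      ∃[ b ] TuringMachine.HaltsWithin machine (evalPoly (proj₁ totalᵖ) (length word)) word b
             × (if b then (∀ qs → Bounded qs → Good (marks qs)) else (∃[ qs ] ¬ Good (marks qs)))
    run k e with check k e zeros (λ j _ → Vec.lookup-replicate j 0)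
      where open Blocks k e
    -- Agreement below 0 is vacuous, so every bounded vector is covered, and `next-track zero`
    -- accepts.
    ... | inj₁ (good , _ , _ , r) = true ,
      (_ , run-halts (weaken (≤-reflexive (proj₂ totalᵖ _)) (Blocks.init-run k e ⟫ r))) , λ qs bd → good qs bd (λ _ ())
    ... | inj₂ (bad , _ , r) = false ,
      (_ , run-halts (weaken (≤-reflexive (proj₂ totalᵖ _)) (Blocks.init-run k e ⟫ r))) , bad

  decides : Decides
  decides = decides-if-checked (checked zero)

-- Candidate sets in a graph

true≢false : true ≢ false
true≢false ()

¬true⇒false : ∀ {b} → ¬ b ≡ true → b ≡ false
¬true⇒false {true}  h = contradiction refl h
¬true⇒false {false} h = refl

∧-elim : ∀ {a b} → a ∧ b ≡ true → a ≡ true × b ≡ true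
∧-elim {true} {true} refl = refl , refl

≡ᵇ-refl : ∀ a → (a ≡ᵇ a) ≡ true
≡ᵇ-refl zero    = refl
≡ᵇ-refl (suc a) = ≡ᵇ-refl a

≡ᵇ-sound : ∀ a b → (a ≡ᵇ b) ≡ true → a ≡ b
≡ᵇ-sound zero    zero    eq = refl
≡ᵇ-sound (suc a) (suc b) eq = cong suc (≡ᵇ-sound a b eq)

or-elim : ∀ {k} (bs : Vec Bool k) → or bs ≡ true → ∃[ j ] lookup bs j ≡ true
or-elim (true  ∷ bs) eq = zero , refl
or-elim (false ∷ bs) eq = let j , eq′ = or-elim bs eq in suc j , eq′

or-intro : ∀ {k} (bs : Vec Bool k) j → lookup bs j ≡ true → or bs ≡ true
or-intro (true  ∷ bs) zero    eq = refl
or-intro (true  ∷ bs) (suc j) eq = refl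
or-intro (false ∷ bs) (suc j) eq = or-intro bs j eq

all-elim : ∀ {n} (f : Fin n → Bool) → all f (allFin n) ≡ true → ∀ u → f u ≡ true
all-elim f eq = from f (trans (cong and (sym (map-tabulate id f))) eq)
  where
  from : ∀ {k} (f : Fin k → Bool) → and (tabulate f) ≡ true → ∀ u → f u ≡ true
  from f eq zero    = proj₁ (∧-elim eq)
  from f eq (suc u) = from (f ∘ suc) (proj₂ (∧-elim {f zero} eq)) u

all-intro : ∀ {A : Set} (f : A → Bool) us → (∀ u → f u ≡ true) → all f us ≡ true
all-intro f []       h = refl
all-intro f (u ∷ us) h rewrite h u = all-intro f us h

hits-found : ∀ {A : Set} (e X : A → Bool) us → hits true e X us ≡ true
hits-found e X []       = refl
hits-found e X (u ∷ us) = hits-found e X us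

hits-elim : ∀ {A : Set} (e X : A → Bool) us → hits false e X us ≡ true → ∃[ u ] e u ≡ true × X u ≡ true
hits-elim e X (u ∷ us) eq with e u in eu | X u in Xu
... | true  | true  = u , eu , Xu
... | true  | false = hits-elim e X us eq
... | false | _     = hits-elim e X us eq

hits-intro : ∀ {n} (e X : Fin n → Bool) u → e u ≡ true → X u ≡ true → hits false e X (allFin n) ≡ true
hits-intro e X u eu Xu = from id u eu Xu
  where
  from : ∀ {k} (f : Fin k → Fin _) u → e (f u) ≡ true → X (f u) ≡ true → hits false e X (tabulate f) ≡ true
  from f zero    eu Xu rewrite eu | Xu = hits-found e X (tabulate (f ∘ suc))
  from f (suc u) eu Xu with e (f zero) ∧ X (f zero)
  ... | true  = hits-found e X (tabulate (f ∘ suc))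
  ... | false = from (f ∘ suc) u eu Xu

hits-cong : ∀ {A : Set} acc (e : A → Bool) {X Y : A → Bool} → (∀ u → X u ≡ Y u) →
            ∀ us → hits acc e X us ≡ hits acc e Y us
hits-cong acc e eq []       = refl
hits-cong acc e {X} {Y} eq (u ∷ us) rewrite eq u = hits-cong (acc ∨ e u ∧ Y u) e eq us

count-cong : ∀ {A : Set} {X Y : A → Bool} → (∀ u → X u ≡ Y u) → ∀ us → count X us ≡ count Y us
count-cong eq []       = refl
count-cong {Y = Y} eq (u ∷ us) rewrite eq u = cong (if Y u then suc else id) (count-cong eq us)

count-subset : ∀ {n} (S : Subset n) → count (lookup S) (allFin n) ≡ ∣ S ∣
count-subset S = trans (from (lookup S) id) (cong ∣_∣ (Vec.tabulate∘lookup S))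
  where
  from : ∀ {n k} (X : Fin n → Bool) (f : Fin k → Fin n) → count X (tabulate f) ≡ ∣ Vec.tabulate (X ∘ f) ∣
  from {k = zero}  X f = refl
  from {k = suc k} X f with X (f zero)
  ... | true  = cong suc (from X (f ∘ suc))
  ... | false = from X (f ∘ suc)

module Candidates {n : ℕ} (G : Graph n) (s : Fin n → Bool) where
  open Graph G

  edge : Fin n → Fin n → Bool
  edge v u = does (v ~? u)

  edge-elim : ∀ {v u} → edge v u ≡ true → v ~ u
  edge-elim {v} {u} eq with yes v~u ← v ~? u = v~u

  edge-intro : ∀ {v u} → v ~ u → edge v u ≡ true
  edge-intro {v} {u} v~u = dec-true (v ~? u) v~u

  neighbour : (Fin n → Bool) → Fin n → Bool
  neighbour X v = hits false (edge v) X (allFin n)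

  neighbour-elim : ∀ X v → neighbour X v ≡ true → ∃[ u ] v ~ u × X u ≡ true
  neighbour-elim X v eq = let u , vu , Xu = hits-elim (edge v) X (allFin n) eq in u , edge-elim vu , Xu

  neighbour-intro : ∀ X {v u} → v ~ u → X u ≡ true → neighbour X v ≡ true
  neighbour-intro X v~u Xu = hits-intro (edge _) X _ (edge-intro v~u) Xu

  candidate : (Fin n → Bool) → Fin n → Bool
  candidate K v = K v ∨ s v ∧ not (neighbour K v)

  -- At all vertices together, "not both" expresses independence of `X` and "at least one" expresses
  -- that `X` is dominating.
  fits : (Fin n → Bool) → Fin n → Bool
  fits X v = X v xor neighbour X v

  fits-cong : ∀ {X Y} → (∀ u → X u ≡ Y u) → ∀ v → fits X v ≡ fits Y v
  fits-cong eq v = cong₂ _xor_ (eq v) (hits-cong false (edge v) eq (allFin n))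

  ∈⇒ : ∀ {S : Subset n} {v} → v ∈ S → lookup S v ≡ true
  ∈⇒ = Vec.[]=⇒lookup

  ⇒∈ : ∀ {S : Subset n} {v} → lookup S v ≡ true → v ∈ S
  ⇒∈ {S} {v} = Vec.lookup⇒[]= v S

  -- Local characterisation of maximal independent sets

  fits⇒maximal : ∀ (S : Subset n) → (∀ v → fits (lookup S) v ≡ true) → MaximalIndependent G S
  fits⇒maximal S fit = independent , maximal
    where
    independent : Independent G (_∈ S)
    independent {u} {v} u∈S v∈S u~v = true≢false
      (trans (sym (fit u)) (cong₂ _xor_ (∈⇒ u∈S) (neighbour-intro (lookup S) u~v (∈⇒ v∈S))))
    maximal : ∀ T → Independent G (_∈ T) → S ⊆ T → T ⊆ S
    maximal T T-indep S⊆T {v} v∈T with lookup S v in Sv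
    ... | true  = ⇒∈ Sv
    ... | false =
      let u , v~u , Su = neighbour-elim (lookup S) v
            (subst (λ b → b xor neighbour (lookup S) v ≡ true) Sv (fit v))
      in  contradiction v~u (T-indep v∈T (S⊆T (⇒∈ Su)))

  module _ (S : Subset n) (S-max : MaximalIndependent G S) where

    private
      independent : Independent G (_∈ S)
      independent = proj₁ S-max

      maximal : ∀ (T : Subset n) → Independent G (_∈ T) → S ⊆ T → T ⊆ S
      maximal = proj₂ S-max

    -- Otherwise `S` together with `v` would be a larger independent set.
    ¬isolated : ∀ v → lookup S v ≡ false → ¬ neighbour (lookup S) v ≡ false
    ¬isolated v Sv none = true≢false (trans (sym (∈⇒ (maximal T T-indep (p⊆p∪q ⁅ v ⁆) (x∈p∪q⁺ (inj₂ (x∈⁅x⁆ v)))))) Sv)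
      where
      T : Subset n
      T = S ∪ ⁅ v ⁆
      far : ∀ {u} → u ∈ S → ¬ v ~ u
      far u∈S v~u = true≢false (trans (sym (neighbour-intro (lookup S) v~u (∈⇒ u∈S))) none)
      T-indep : Independent G (_∈ T)
      T-indep u∈T w∈T u~w with x∈p∪q⁻ S ⁅ v ⁆ u∈T | x∈p∪q⁻ S ⁅ v ⁆ w∈T
      ... | inj₁ u∈S | inj₁ w∈S = independent u∈S w∈S u~w
      ... | inj₁ u∈S | inj₂ w∈v with refl ← x∈⁅y⁆⇒x≡y v w∈v = far u∈S (~-sym u~w)
      ... | inj₂ u∈v | inj₁ w∈S with refl ← x∈⁅y⁆⇒x≡y v u∈v = far w∈S u~w
      ... | inj₂ u∈v | inj₂ w∈v =
        ~-irrefl (trans (x∈⁅y⁆⇒x≡y v u∈v) (sym (x∈⁅y⁆⇒x≡y v w∈v))) u~w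

    maximal⇒fits : ∀ v → fits (lookup S) v ≡ true
    maximal⇒fits v with lookup S v in Sv | neighbour (lookup S) v in Nv
    ... | true  | false = refl
    ... | false | true  = refl
    ... | true  | true  = let u , v~u , Su = neighbour-elim (lookup S) v Nv
                          in  contradiction v~u (independent (⇒∈ Sv) (⇒∈ Su))
    ... | false | false = contradiction Nv (¬isolated v Sv)

  -- Recovering a maximal independent set from its traces in the cliques

  module _ {r l : ℕ} (P : Partition G r l) (r≤1 : ∀ (i j : Fin r) → i ≡ j)
           (s-true  : ∀ v → s v ≡ true  → ∃[ i ] Partition.part P v ≡ inj₁ i)
           (s-false : ∀ v → s v ≡ false → ∃[ j ] Partition.part P v ≡ inj₂ j)
           (S : Subset n) (S-max : MaximalIndependent G S) where
    open Partition P

    private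
      S-indep : Independent G (_∈ S)
      S-indep = proj₁ S-max

    inClique? : ∀ j v → Dec (lookup S v ≡ true × part v ≡ inj₂ j)
    inClique? j v = (lookup S v Bool.≟ true) ×-dec (Sum.≡-dec Fin._≟_ Fin._≟_ (part v) (inj₂ j))

    -- The position of the member of S in the clique j, or n if there is none.
    trace : Fin l → ℕ
    trace j with any? (inClique? j)
    ... | yes (v , _) = toℕ v
    ... | no  _       = n

    trace≤n : ∀ j → trace j ≤ n
    trace≤n j with any? (inClique? j)
    ... | yes (v , _) = <⇒≤ (toℕ<n v)
    ... | no  _       = ≤-refl

    -- The default value `n` is not the position of any vertex, so an empty trace contributes no
    -- member.
    trace-∈ : ∀ j v → toℕ v ≡ trace j → lookup S v ≡ true
    trace-∈ j v eq with any? (inClique? j)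
    ... | yes (u , Su , _) = subst (λ z → lookup S z ≡ true) (sym (toℕ-injective eq)) Su
    ... | no  _            = contradiction eq (<⇒≢ (toℕ<n v))

    -- Two distinct members of `S` in one clique would be adjacent, so the vertex found by the
    -- search is the only one.
    trace-complete : ∀ j v → lookup S v ≡ true → part v ≡ inj₂ j → toℕ v ≡ trace j
    trace-complete j v Sv pv with any? (inClique? j)
    ... | no  none = contradiction (v , Sv , pv) none
    ... | yes (u , Su , pu) with v Fin.≟ u
    ... | yes v≡u = cong toℕ v≡u
    ... | no  v≢u = contradiction (clique j pv pu v≢u) (S-indep (⇒∈ Sv) (⇒∈ Su))

    traced : Fin n → Bool
    traced u = or (Vec.map (toℕ u ≡ᵇ_) (Vec.tabulate trace))

    lookup-traced : ∀ (u : Fin n) j → lookup (Vec.map (toℕ u ≡ᵇ_) (Vec.tabulate trace)) j ≡ (toℕ u ≡ᵇ trace j)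
    lookup-traced u j = trans (Vec.lookup-map j (toℕ u ≡ᵇ_) (Vec.tabulate trace))
      (cong (toℕ u ≡ᵇ_) (Vec.lookup∘tabulate trace j))

    traced-∈ : ∀ u → traced u ≡ true → lookup S u ≡ true
    traced-∈ u eq = let j , eq′ = or-elim (Vec.map (toℕ u ≡ᵇ_) (Vec.tabulate trace)) eq
      in trace-∈ j u (≡ᵇ-sound (toℕ u) (trace j) (trans (sym (lookup-traced u j)) eq′))

    traced-complete : ∀ u → lookup S u ≡ true → s u ≡ false → traced u ≡ true
    traced-complete u Su su = let j , pu = s-false u su
      in or-intro (Vec.map (toℕ u ≡ᵇ_) (Vec.tabulate trace)) j (trans (lookup-traced u j)
           (trans (cong (toℕ u ≡ᵇ_) (sym (trace-complete j u Su pu))) (≡ᵇ-refl (toℕ u))))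

    s-independent : ∀ {u v} → s u ≡ true → s v ≡ true → ¬ u ~ v
    s-independent {u} {v} su sv =
      let i , pu = s-true u su
          j , pv = s-true v sv
      in  independent i pu (trans pv (cong inj₁ (r≤1 j i)))

    -- The traces give all members of `S` in the cliques. A vertex of the independent part belongs
    -- to `S` exactly when none of its neighbours is traced: independence gives one direction,
    -- maximality the other.
    traced-candidate : ∀ v → candidate traced v ≡ lookup S v
    traced-candidate v with traced v in tv
    ... | true  = sym (traced-∈ v tv)
    ... | false with s v in sv
    ... | false = sym (¬true⇒false λ Sv → true≢false (trans (sym (traced-complete v Sv sv)) tv))
    ... | true with lookup S v in Sv
    ... | true  = cong not (¬true⇒false λ Nv →
      let u , v~u , tu = neighbour-elim traced v Nv
      in  S-indep (⇒∈ Sv) (⇒∈ (traced-∈ u tu)) v~u)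
    -- By maximality `v` has a neighbour `u` in `S`; as `v` is in the independent part, `u` lies in
    -- a clique and is traced.
    ... | false = cong not (neighbour-intro traced v~u (traced-complete u Su
                    (¬true⇒false λ su → s-independent sv su v~u)))
      where
      near : ∃[ u ] v ~ u × lookup S u ≡ true
      near = neighbour-elim (lookup S) v (subst (λ b → b xor neighbour (lookup S) v ≡ true) Sv (maximal⇒fits S S-max v))
      u = proj₁ near
      v~u = proj₁ (proj₂ near)
      Su = proj₂ (proj₂ near)

-- Correctness of the answer

module Correctness {r l : ℕ} (useS : Bool) (r≤1 : ∀ (i j : Fin r) → i ≡ j)
  (s-true  : ∀ x → Passes.inS useS l (toℕ (join r l x)) ≡ true  → ∃[ i ] x ≡ inj₁ i)
  (s-false : ∀ x → Passes.inS useS l (toℕ (join r l x)) ≡ false → ∃[ j ] x ≡ inj₂ j) where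

  open Machine useS l using (machine; m)
  open Passes useS l using (inS; module Blocks; decides)

  module _ (I : PartitionedGraph r l) where
    open PartitionedGraph I
    open Partition partition using (part)

    index : Fin order → ℕ
    index v = toℕ (join r l (part v))

    open Candidates graph (inS ∘ index)
    open Blocks index edge

    fits-okay : ∀ M → (∀ v → fits (λ u → proj₁ (candidates M u)) v ≡ true) →
      (∀ v → fits (λ u → proj₂ (candidates M u)) v ≡ true) → all (Passes.okay useS l ∘ verified M) (allFin order) ≡ true
    fits-okay M fit₁ fit₂ = all-intro _ (allFin order) (λ v → cong₂ _∧_ (fit₁ v) (fit₂ v))

    -- However the marks are placed, passing verification certifies that both candidates are maximal
    -- independent sets, so their sizes agree.
    wellCovered⇒good : WellCovered graph → ∀ M → Good M
    wellCovered⇒good wc M ok = begin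
      count X₁ (allFin order)                      ≡⟨ count-cong (Vec.lookup∘tabulate X₁) (allFin order) ⟨
      count (lookup (Vec.tabulate X₁)) (allFin order) ≡⟨ count-subset (Vec.tabulate X₁) ⟩
      ∣ Vec.tabulate X₁ ∣                          ≡⟨ wc _ _ (maximal X₁ (λ v → proj₁ (fit v))) (maximal X₂ (λ v → proj₂ (fit v))) ⟩
      ∣ Vec.tabulate X₂ ∣                          ≡⟨ count-subset (Vec.tabulate X₂) ⟨
      count (lookup (Vec.tabulate X₂)) (allFin order) ≡⟨ count-cong (Vec.lookup∘tabulate X₂) (allFin order) ⟩
      count X₂ (allFin order)                      ∎
      where
      open ≡-Reasoning
      X₁ X₂ : Fin order → Bool
      X₁ u = proj₁ (candidates M u)
      X₂ u = proj₂ (candidates M u)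
      fit : ∀ v → fits X₁ v ≡ true × fits X₂ v ≡ true
      -- The two compatibility bits are, by definition, `fits` of the two candidates.
      fit v = ∧-elim (all-elim (Passes.okay useS l ∘ verified M) ok v)
      maximal : ∀ X → (∀ v → fits X v ≡ true) → MaximalIndependent graph (Vec.tabulate X)
      maximal X h = fits⇒maximal (Vec.tabulate X)
        (λ v → trans (fits-cong (Vec.lookup∘tabulate X) v) (h v))

    -- Given two maximal independent sets, the tracks are placed on their traces; the candidates are
    -- then these very sets, and the test of this pair compares their sizes.
    good⇒wellCovered : (∀ qs → Bounded qs → Good (marks qs)) → WellCovered graph
    good⇒wellCovered good S T S-max T-max = begin
      ∣ S ∣                                   ≡⟨ count-subset S ⟨
      count (lookup S) (allFin order)         ≡⟨ count-cong is-S (allFin order) ⟨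
      count (λ u → proj₁ (candidates (marks qs) u)) (allFin order)
        ≡⟨ good qs bounded (fits-okay (marks qs)
             (λ v → trans (fits-cong is-S v) (maximal⇒fits S S-max v))
             (λ v → trans (fits-cong is-T v) (maximal⇒fits T T-max v))) ⟩
      count (λ u → proj₂ (candidates (marks qs) u)) (allFin order) ≡⟨ count-cong is-T (allFin order) ⟩
      count (lookup T) (allFin order)         ≡⟨ count-subset T ⟩
      ∣ T ∣                                   ∎
      where
      open ≡-Reasoning
      traceOf : ∀ (S : Subset order) → MaximalIndependent graph S → Fin l → ℕ
      traceOf = trace partition r≤1 (s-true ∘ part) (s-false ∘ part)
      ps₁ ps₂ : Vec ℕ l
      ps₁ = Vec.tabulate (traceOf S S-max)
      ps₂ = Vec.tabulate (traceOf T T-max)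
      -- The trace of `S` fills the first `l` tracks and that of `T` the last `l`, matching the
      -- split in `chosen`.
      qs : Vec ℕ m
      qs = ps₁ Vec.++ ps₂
      bounded₁ : ∀ S S-max j → lookup (Vec.tabulate (traceOf S S-max)) j ≤ order
      bounded₁ S S-max j = subst (_≤ order) (sym (Vec.lookup∘tabulate _ j))
        (trace≤n partition r≤1 (s-true ∘ part) (s-false ∘ part) S S-max j)
      bounded : Bounded qs
      bounded j rewrite Vec.lookup-splitAt l ps₁ ps₂ j with splitAt l j
      ... | inj₁ j₁ = bounded₁ S S-max j₁
      ... | inj₂ j₂ = bounded₁ T T-max j₂
      halves : ∀ u → Vec.take l (marks qs u) ≡ Vec.map (toℕ u ≡ᵇ_) ps₁ × Vec.drop l (marks qs u) ≡ Vec.map (toℕ u ≡ᵇ_) ps₂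
      halves u = Vec.++-injective (Vec.take l (marks qs u)) (Vec.map (toℕ u ≡ᵇ_) ps₁)
        (trans (Vec.take++drop≡id l (marks qs u)) (Vec.map-++ (toℕ u ≡ᵇ_) ps₁ ps₂))
      candidate-cong : ∀ {K L} → (∀ u → K u ≡ L u) → ∀ v → candidate K v ≡ candidate L v
      candidate-cong eq v = cong₂ (λ a b → a ∨ inS (index v) ∧ not b) (eq v) (hits-cong false (edge v) eq (allFin order))
      is-S : ∀ u → proj₁ (candidates (marks qs) u) ≡ lookup S u
      is-S u = trans (candidate-cong (λ v → cong or (proj₁ (halves v))) u)
        (traced-candidate partition r≤1 (s-true ∘ part) (s-false ∘ part) S S-max u)
      is-T : ∀ u → proj₂ (candidates (marks qs) u) ≡ lookup T u
      is-T u = trans (candidate-cong (λ v → cong or (proj₂ (halves v))) u)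
        (traced-candidate partition r≤1 (s-true ∘ part) (s-false ∘ part) T T-max u)

    reflects : ∀ b → (if b then (∀ qs → Bounded qs → Good (marks qs)) else (∃[ qs ] ¬ Good (marks qs))) →
               Reflects (WellCovered graph) b
    reflects true  good       = ofʸ (good⇒wellCovered good)
    reflects false (qs , bad) = ofⁿ (λ wc → bad (wellCovered⇒good wc (marks qs)))

  polynomialTime : PolynomialTime WC-⟨ r , l ⟩G
  polynomialTime = machine , proj₁ decides , λ I →
    -- For this choice of indices and adjacency bits, the word analysed is the encoding of the
    -- instance by definition.
    let b , halts , outcome = proj₂ decides (index I) (Candidates.edge (PartitionedGraph.graph I) (inS ∘ index I))
    in  b , halts , reflects I b outcome

theorem2 : ∀ (l : ℕ) → PolynomialTime WC-⟨ 0 , l ⟩G × PolynomialTime WC-⟨ 1 , l ⟩G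
theorem2 l = Correctness.polynomialTime false (λ ()) s-true₀ s-false₀ , Correctness.polynomialTime true r≤1 s-true₁ s-false₁
  where
  r≤1 : ∀ (i j : Fin 1) → i ≡ j
  r≤1 zero zero = refl
  s-true₀ : ∀ x → Passes.inS false l (toℕ (join 0 l x)) ≡ true → ∃[ i ] x ≡ inj₁ i
  -- `inS` reduces only once the index is split; with the flag off it is false in both cases.
  s-true₀ (inj₂ j) eq with toℕ j
  s-true₀ (inj₂ j) () | zero
  s-true₀ (inj₂ j) () | suc _
  s-false₀ : ∀ x → Passes.inS false l (toℕ (join 0 l x)) ≡ false → ∃[ j ] x ≡ inj₂ j
  s-false₀ (inj₂ j) _ = j , refl
  s-true₁ : ∀ x → Passes.inS true l (toℕ (join 1 l x)) ≡ true → ∃[ i ] x ≡ inj₁ i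
  s-true₁ (inj₁ i) _ = i , refl
  s-false₁ : ∀ x → Passes.inS true l (toℕ (join 1 l x)) ≡ false → ∃[ j ] x ≡ inj₂ j
  s-false₁ (inj₁ zero) ()
  s-false₁ (inj₂ j)    _ = j , refl
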